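{- Let $A,B,C\in\mathbb{Z}$ and $F(x,y)=Ax^4+Bx^3y+(C-2A)x^2y^2-Bxy^3+Ay^4$. (a) For an odd prime $p$, $Q_F$ is maximal at $p$ if and only if $p$ does not divide all of $A,B,C$, $B^2-4AC\not\equiv0\pmod{p^2}$, and: $(4A-C)^2+4B^2\not\equiv 0\pmod{p^3}$ when $p$ divides both $4A-C$ and $B$; $(4A-C)^2+4B^2\not\equiv0\pmod{p^2}$ when $p$ does not divide both $4A-C$ and $B$. (b) $Q_F$ is maximal at $2$ if and only if $A,B,C$ are not all even, $C\not\equiv0\pmod4$, and, when $C$ is odd and $B$ is even, $A\not\equiv0\pmod 4$ and $A-B+C\not\equiv0\pmod4$.
   Context: For an integral binary quartic form $F=a_4x^4+a_3x^3y+a_2x^2y^2+a_1xy^3+a_0y^4$, $Q_F$ is the quartic ring associated to $F$ by Birch–Merriman/Nakagawa (equivalently, by Wood, the quartic ring corresponding under Bhargava's parametrization to the pair of ternary quadratic forms $(U_0,V_F)$ with $U_0=-xy+z^2$, $V_F=a_0x^2+a_4y^2+a_2z^2+a_1xz+a_3yz$); when $F$ is irreducible and $\theta$ is a root of $F(x,1)$, $Q_F=\mathbb{Z}\oplus\mathbb{Z}a_4\theta\oplus\mathbb{Z}(a_4\theta^2+a_3\theta)\oplus\mathbb{Z}(a_4\theta^3+a_3\theta^2+a_2\theta)$. $Q_F$ is maximal at a prime $p$ if $\mathbb{Z}_p\otimes_{\mathbb{Z}}Q_F$ is a maximal quartic ring over $\mathbb{Z}_p$. -}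

module Defs where

open import Data.Nat using (ℕ; _^_)
open import Data.Integer using (ℤ; +_; _+_; _*_; -_; _-_)
open import Data.Product using (Σ; _×_)
open import Relation.Nullary using (¬_)
open import Relation.Binary.PropositionalEquality using (_≡_)

record BinQuartic : Set where
  constructor quartic
  field
    a4 a3 a2 a1 a0 : ℤ

formABC : ℤ → ℤ → ℤ → BinQuartic
formABC A B C = quartic A B (C - (+ 2) * A) (- B) A

-- Elements of Q_F written in the Z-basis 1, ζ1, ζ2, ζ3, where (for F
-- irreducible, θ a root of F(x,1)) ζ1 = a4 θ, ζ2 = a4 θ² + a3 θ,
-- ζ3 = a4 θ³ + a3 θ² + a2 θ.
record V4 : Set where
  constructor v4
  field
    c0 c1 c2 c3 : ℤ

infixl 6 _⊕_
_⊕_ : V4 → V4 → V4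
v4 x0 x1 x2 x3 ⊕ v4 y0 y1 y2 y3 = v4 (x0 + y0) (x1 + y1) (x2 + y2) (x3 + y3)

⊖_ : V4 → V4
⊖ v4 x0 x1 x2 x3 = v4 (- x0) (- x1) (- x2) (- x3)

infixl 7 _•_
_•_ : ℤ → V4 → V4
s • v4 x0 x1 x2 x3 = v4 (s * x0) (s * x1) (s * x2) (s * x3)

-- Multiplication table of Q_F (Birch–Merriman / Nakagawa / Wood):
--   ζ1ζ1 = -a3 ζ1 + a4 ζ2
--   ζ1ζ2 = -a2 ζ1 + a4 ζ3
--   ζ1ζ3 = -a0a4 - a1 ζ1
--   ζ2ζ2 = -a0a4 - a1 ζ1 - a2 ζ2 + a3 ζ3
--   ζ2ζ3 = -a0a3 - a0 ζ1 - a1 ζ2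
--   ζ3ζ3 = -a0a2 - a0 ζ2 - a1 ζ3
mulQ : BinQuartic → V4 → V4 → V4
mulQ (quartic a4 a3 a2 a1 a0) (v4 x0 x1 x2 x3) (v4 y0 y1 y2 y3) =
  (x0 * y0) • v4 (+ 1) (+ 0) (+ 0) (+ 0)
  ⊕ (x0 * y1 + x1 * y0) • v4 (+ 0) (+ 1) (+ 0) (+ 0)
  ⊕ (x0 * y2 + x2 * y0) • v4 (+ 0) (+ 0) (+ 1) (+ 0)
  ⊕ (x0 * y3 + x3 * y0) • v4 (+ 0) (+ 0) (+ 0) (+ 1)
  ⊕ (x1 * y1) • v4 (+ 0) (- a3) a4 (+ 0)
  ⊕ (x1 * y2 + x2 * y1) • v4 (+ 0) (- a2) (+ 0) a4
  ⊕ (x1 * y3 + x3 * y1) • v4 (- (a0 * a4)) (- a1) (+ 0) (+ 0)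
  ⊕ (x2 * y2) • v4 (- (a0 * a4)) (- a1) (- a2) a3
  ⊕ (x2 * y3 + x3 * y2) • v4 (- (a0 * a3)) (- a0) (- a1) (+ 0)
  ⊕ (x3 * y3) • v4 (- (a0 * a2)) (+ 0) (- a0) (- a1)

-- A proper overring of Q_F of p-power index, presented as R' = p^{-k} L,
-- where L is a subgroup of Q_F with p^k Q_F ⊆ L ⊆ Q_F, R' is closed under
-- multiplication (x, y ∈ L ⇒ x·y ∈ p^k L), and R' ≠ Q_F (L ≠ p^k Q_F).
-- R' contains 1 since p^k·1 ∈ L.
record ProperOverring (F : BinQuartic) (p k : ℕ) (L : V4 → Set) : Set where
  field
    contains  : ∀ v → L (+ (p ^ k) • v)
    add-closed : ∀ {x y} → L x → L y → L (x ⊕ y)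
    neg-closed : ∀ {x} → L x → L (⊖ x)
    mul-closed : ∀ {x y} → L x → L y →
                 Σ V4 (λ z → L z × mulQ F x y ≡ + (p ^ k) • z)
    proper    : Σ V4 (λ x → L x × ¬ (Σ V4 (λ v → x ≡ + (p ^ k) • v)))

-- Z_p ⊗ Q_F is a maximal quartic ring over Z_p iff Q_F has no proper
-- overring (inside Q_F ⊗ Q) of p-power index.
MaximalAt : BinQuartic → ℕ → Set₁
MaximalAt F p = ¬ (Σ ℕ (λ k → Σ (V4 → Set) (λ L → ProperOverring F p k L)))

{-# OPTIONS --safe #-}
module Submission where

open import Defs
open import Algebra.Bundles using (CommutativeRing)
import Algebra.Solver.Ring.NaturalCoefficients.Default as SemiringSolver
open import Data.Fin using (suc)
open import Data.Fin.Patterns using (0F; 1F; 2F; 3F; 4F; 5F; 6F; 7F; 8F; 9F)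
open import Data.Integer using (ℤ; +_; _+_; _*_; -_; _-_; ∣_∣; ≢-nonZero)
open import Data.Integer.Divisibility using (_∣_)
open import Data.Integer.Divisibility.Signed
  using (divides; ∣ᵤ⇒∣; ∣⇒∣ᵤ; ∣-refl; ∣-trans; ∣m∣n⇒∣m+n; ∣m∣n⇒∣m-n; ∣m⇒∣-m; ∣n⇒∣m*n; ∣m⇒∣m*n;
         *-monoʳ-∣; *-monoˡ-∣; *-cancelˡ-∣)
  renaming (_∣_ to _∣ˢ_; _∣?_ to _∣ˢ?_)
open import Data.Integer.DivMod using (_/ℕ_; _%ℕ_; n%ℕd<d; a≡a%ℕn+[a/ℕn]*n)
import Data.Integer.Properties as ℤ
open import Algebra.Properties.AbelianGroup ℤ.+-0-abelianGroup using (∙-cancelʳ)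
open import Data.Integer.Solver using (module +-*-Solver)
open import Data.Nat using (ℕ; zero; suc; NonZero; _^_; s≤s)
import Data.Nat as ℕ
import Data.Nat.Coprimality as ℕ using (Coprime; coprime-divisor; coprime-/gcd)
import Data.Nat.Divisibility as ℕ
open import Data.Nat.DivMod using (_/_; m/n*n≡m)
open import Data.Nat.GCD using (gcd; gcd[m,n]∣m; gcd[m,n]∣n; gcd[m,n]≢0)
open import Data.Nat.Induction using (<-wellFounded)
open import Data.Nat.Primality
  using (Prime; euclidsLemma; prime⇒nonZero; irreducible[2]; ¬prime[1]; prime[2])
import Data.Nat.Properties as ℕ
open import Data.Product using (Σ; ∃; ∃₂; _×_; _,_; proj₁; proj₂)
open import Data.Sum using (_⊎_; inj₁; inj₂; [_,_]′; reduce)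
open import Data.Vec using (Vec; _∷_; [])
open import Function using (_∘_; id)
open import Function.Bundles using (_⇔_; mk⇔)
open import Induction.WellFounded using (Acc; acc)
open import Level using (0ℓ)
open import Relation.Binary.PropositionalEquality
  using (_≡_; _≢_; refl; sym; trans; cong; cong₂; subst; isEquivalence; module ≡-Reasoning)
open import Relation.Nullary using (¬_; yes; no; contradiction)
open import Relation.Nullary.Decidable using (decidable-stable; from-no; _×-dec_)

-- Let θ be a root of F(x, 1) and η = θ - 1/θ. Since F = G(x² - y², x y) for G = A u² + B u v + C v²,
-- Q_F is a quadratic extension of the order O = ℤ[α], α = A η, of discriminant B² - 4 A C: it equals
-- O ⊕ J θ with J = ℤ A + ℤ (α + B) and θ² = η θ + 1. Its relative different J (θ + 1/θ) is controlled by
-- (θ + 1/θ)² = η² + 4, of norm ((4 A - C)² + 4 B²) / A².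
--
-- For x in an overring of p-power index, the powers of the relative norm of x have bounded denominators.
-- So if O is maximal at p, this norm lies in O, and comparing the norms of x and x + 1, so does the relative
-- trace. The congruences say that O is maximal at p and that every v in Q_F with relative norm in p² O and
-- relative trace in p O lies in p Q_F, which rules out proper overrings. Conversely, when a congruence
-- fails there is w outside p Q_F with w² = p f w + p² e, and Q_F[w/p] is a proper overring.

-- No root θ occurs in the code: A may vanish and F may be reducible, so θ, η and quotients by A
-- only suggest formulas, and these are checked as polynomial identities in A, B, C and coordinates.
-- An overring is known only as a closed predicate, without a basis or an integral equation; its
-- powers give access to multiplicative quantities alone, which is why norms carry the argument. For
-- v = a + b α + m β + n γ, with β = A θ and γ = (α + B) θ, trace² - 4 norm = (v - conj v)² = (m A +
-- n (B + α))² (η² + 4). Let η' be the conjugate of η and E = 4 A - C. Then A (η² + 4) = E - B η, B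
-- + α = - A η', and (E - B η) (E - B η') = E² + 4 B². So (m, n) = (E, B) is the critical direction:
-- it turns the square into a multiple of E² + 4 B². When p divides E and B, this direction divided
-- by p produces (E² + 4 B²) / p instead, whence the exponent 3. At p = 2 the factor 4 destroys the
-- information, and parities of coordinates take over.

module _ {a ℓ} (R : CommutativeRing a ℓ) where
  open CommutativeRing R hiding (isEquivalence)
    renaming (_+_ to _∔_; _*_ to _∙_; -_ to ∸_; refl to ≈-refl; sym to ≈-sym; trans to ≈-trans)
  open SemiringSolver commutativeSemiring
  open import Relation.Binary.Reasoning.Setoid setoid
  open import Algebra.Properties.Ring ring using (-‿distribˡ-*; -‿distribʳ-*)
  open import Algebra.Properties.AbelianGroup +-abelianGroup using (⁻¹-∙-comm)

  interchange : ∀ w x y z → (w ∙ x) ∙ (y ∙ z) ≈ (w ∙ y) ∙ (x ∙ z)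
  interchange = solve 4 (λ w x y z → (w :* x) :* (y :* z) := (w :* y) :* (x :* z)) ≈-refl

  module _ (p w : Carrier) where

    -- p times the ring R + (w / p) R when w / p is integral of degree two over R.
    Adjoin : Carrier → Set _
    Adjoin v = ∃₂ λ u t → v ≈ p ∙ u ∔ t ∙ w

    adjoin-multiple : ∀ v → Adjoin (p ∙ v)
    adjoin-multiple v = v , 0# , ≈-sym (≈-trans (+-congˡ (zeroˡ w)) (+-identityʳ _))

    adjoin-generator : Adjoin w
    adjoin-generator = 0# , 1# , ≈-sym (≈-trans (+-cong (zeroʳ p) (*-identityˡ w)) (+-identityˡ w))

    adjoin-sum : ∀ {x y} → Adjoin x → Adjoin y → Adjoin (x ∔ y)
    adjoin-sum (u , t , x≈) (u′ , t′ , y≈) = u ∔ u′ , t ∔ t′ , ≈-trans (+-cong x≈ y≈)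
      (solve 6 (λ p w u t u′ t′ → (p :* u :+ t :* w) :+ (p :* u′ :+ t′ :* w) :=
         p :* (u :+ u′) :+ (t :+ t′) :* w) ≈-refl p w u t u′ t′)

    adjoin-negation : ∀ {x} → Adjoin x → Adjoin (∸ x)
    adjoin-negation (u , t , x≈) = ∸ u , ∸ t , ≈-trans (-‿cong x≈)
      (≈-trans (≈-sym (⁻¹-∙-comm (p ∙ u) (t ∙ w))) (+-cong (-‿distribʳ-* p u) (-‿distribˡ-* t w)))

    -- The hypothesis says (w / p)² = f (w / p) + e, so the square of w / p falls back into the span
    -- of 1 and w / p.
    adjoin-product : ∀ {f e} → w ∙ w ≈ p ∙ (f ∙ w ∔ p ∙ e) → ∀ {x y} → Adjoin x → Adjoin y →
      ∃ λ z → Adjoin z × x ∙ y ≈ p ∙ z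
    adjoin-product {f} {e} w² {x} {y} (u , t , x≈) (u′ , t′ , y≈) =
      p ∙ (u ∙ u′ ∔ t ∙ t′ ∙ e) ∔ (u ∙ t′ ∔ t ∙ u′ ∔ t ∙ t′ ∙ f) ∙ w , (_ , _ , ≈-refl) , (begin
      x ∙ y
        ≈⟨ *-cong x≈ y≈ ⟩
      (p ∙ u ∔ t ∙ w) ∙ (p ∙ u′ ∔ t′ ∙ w)
        ≈⟨ solve 6 (λ p w u t u′ t′ → (p :* u :+ t :* w) :* (p :* u′ :+ t′ :* w) :=
             p :* (p :* (u :* u′) :+ (u :* t′ :+ t :* u′) :* w) :+ t :* t′ :* (w :* w))
             ≈-refl p w u t u′ t′ ⟩
      p ∙ (p ∙ (u ∙ u′) ∔ (u ∙ t′ ∔ t ∙ u′) ∙ w) ∔ t ∙ t′ ∙ (w ∙ w)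
        ≈⟨ +-congˡ (*-congˡ w²) ⟩
      p ∙ (p ∙ (u ∙ u′) ∔ (u ∙ t′ ∔ t ∙ u′) ∙ w) ∔ t ∙ t′ ∙ (p ∙ (f ∙ w ∔ p ∙ e))
        ≈⟨ solve 8 (λ p w f e u t u′ t′ →
             p :* (p :* (u :* u′) :+ (u :* t′ :+ t :* u′) :* w) :+ t :* t′ :* (p :* (f :* w :+ p :* e)) :=
             p :* (p :* (u :* u′ :+ t :* t′ :* e) :+ (u :* t′ :+ t :* u′ :+ t :* t′ :* f) :* w))
             ≈-refl p w f e u t u′ t′ ⟩
      p ∙ (p ∙ (u ∙ u′ ∔ t ∙ t′ ∙ e) ∔ (u ∙ t′ ∔ t ∙ u′ ∔ t ∙ t′ ∙ f) ∙ w) ∎)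

-- Divisibility of integers, and rationals with bounded powers

open +-*-Solver using (Polynomial; var; con; _:+_; _:*_; _:-_; :-_; ⟦_⟧; ⟦_⟧↓; prove; solve; _:=_)

∣-resp : ∀ {d x y} → x ≡ y → d ∣ˢ x → d ∣ˢ y
∣-resp refl d∣x = d∣x

∣-linear : ∀ {d x y} s t → d ∣ˢ x → d ∣ˢ y → d ∣ˢ s * x + t * y
∣-linear s t d∣x d∣y = ∣m∣n⇒∣m+n (∣n⇒∣m*n s d∣x) (∣n⇒∣m*n t d∣y)

∣-* : ∀ {c d x y} → c ∣ˢ x → d ∣ˢ y → c * d ∣ˢ x * y
∣-* {c} {d} (divides q refl) (divides r refl) = divides (q * r)
  (solve 4 (λ c d q r → q :* c :* (r :* d) := q :* r :* (c :* d)) refl c d q r)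

-- Coprimality makes q divide every `s i`; the quotients satisfy the same recurrence, so for q ≥ 2
-- the value `s 0` would descend forever. For q = 0 the recurrence forces c = 0, and then 0 is a
-- common divisor, which coprimality equates with 1.
coprime-quotients-unit : ∀ c q → ℕ.Coprime q c → (s : ℕ → ℕ) → s 0 ≢ 0 →
  (∀ i → c ℕ.* s i ≡ q ℕ.* s (suc i)) → q ≡ 1
coprime-quotients-unit c zero q⊥c s s0≢0 eq = q⊥c (ℕ.∣-refl , subst (0 ℕ.∣_) (sym c≡0) ℕ.∣-refl)
  where
  c≡0 : c ≡ 0
  c≡0 = [ id , (λ s0≡0 → contradiction s0≡0 s0≢0) ]′ (ℕ.m*n≡0⇒m≡0∨n≡0 c (eq 0))
coprime-quotients-unit c (suc zero) q⊥c s s0≢0 eq = refl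
coprime-quotients-unit c q@(suc (suc _)) q⊥c s s0≢0 eq =
  contradiction eq (descend s (<-wellFounded (s 0)) s0≢0)
  where
  descend : ∀ s → Acc ℕ._<_ (s 0) → s 0 ≢ 0 → ¬ (∀ i → c ℕ.* s i ≡ q ℕ.* s (suc i))
  descend s (acc smaller) s0≢0 eq = descend r (smaller r0<s0) r0≢0 eq′
    where
    q∣s : ∀ i → q ℕ.∣ s i
    q∣s i = ℕ.coprime-divisor q⊥c (subst (q ℕ.∣_) (sym (eq i)) (ℕ.m∣m*n (s (suc i))))
    r : ℕ → ℕ
    r i = ℕ.quotient (q∣s i)
    s≡ : ∀ i → s i ≡ q ℕ.* r i
    s≡ i = ℕ.m∣n⇒n≡m*quotient (q∣s i)
    r0≢0 : r 0 ≢ 0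
    r0≢0 r0≡0 = s0≢0 (trans (s≡ 0) (trans (cong (q ℕ.*_) r0≡0) (ℕ.*-zeroʳ q)))
    r0<s0 : r 0 ℕ.< s 0
    r0<s0 = let instance s0≢0′ = ℕ.≢-nonZero s0≢0 in ℕ.quotient-< (q∣s 0)
    eq′ : ∀ i → c ℕ.* r i ≡ q ℕ.* r (suc i)
    eq′ i = ℕ.*-cancelˡ-≡ _ _ q (begin
      q ℕ.* (c ℕ.* r i)        ≡⟨ ℕ.*-comm q (c ℕ.* r i) ⟩
      c ℕ.* r i ℕ.* q          ≡⟨ ℕ.*-assoc c _ q ⟩
      c ℕ.* (r i ℕ.* q)        ≡⟨ cong (c ℕ.*_) (trans (ℕ.*-comm (r i) q) (sym (s≡ i))) ⟩
      c ℕ.* s i                ≡⟨ eq i ⟩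
      q ℕ.* s (suc i)          ≡⟨ cong (q ℕ.*_) (s≡ (suc i)) ⟩
      q ℕ.* (q ℕ.* r (suc i))  ∎)
      where open ≡-Reasoning

-- A rational number c / q all of whose powers lie in (1 / s 0) ℤ is an integer.
power-bounded⇒∣ : ∀ (c q : ℤ) → q ≢ + 0 → (s : ℕ → ℤ) → s 0 ≢ + 0 →
  (∀ i → c * s i ≡ q * s (suc i)) → q ∣ˢ c
power-bounded⇒∣ c q q≢0 s s0≢0 eq = ∣ᵤ⇒∣ (subst (ℕ._∣ ∣ c ∣) q≡g (gcd[m,n]∣n ∣ q ∣ ∣ c ∣))
  where
  g : ℕ
  g = gcd ∣ q ∣ ∣ c ∣
  instance
    g≢0 : NonZero g
    g≢0 = ℕ.≢-nonZero (gcd[m,n]≢0 ∣ q ∣ ∣ c ∣ (inj₁ (q≢0 ∘ ℤ.∣i∣≡0⇒i≡0)))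
  q′ c′ : ℕ
  q′ = ∣ q ∣ / g
  c′ = ∣ c ∣ / g
  q≡ : q′ ℕ.* g ≡ ∣ q ∣
  q≡ = m/n*n≡m (gcd[m,n]∣m ∣ q ∣ ∣ c ∣)
  c≡ : c′ ℕ.* g ≡ ∣ c ∣
  c≡ = m/n*n≡m (gcd[m,n]∣n ∣ q ∣ ∣ c ∣)
  eq′ : ∀ i → c′ ℕ.* ∣ s i ∣ ≡ q′ ℕ.* ∣ s (suc i) ∣
  eq′ i = ℕ.*-cancelˡ-≡ _ _ g (begin
    g ℕ.* (c′ ℕ.* ∣ s i ∣)        ≡⟨ ℕ.*-assoc g c′ _ ⟨
    g ℕ.* c′ ℕ.* ∣ s i ∣          ≡⟨ cong (ℕ._* ∣ s i ∣) (trans (ℕ.*-comm g c′) c≡) ⟩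
    ∣ c ∣ ℕ.* ∣ s i ∣             ≡⟨ ℤ.abs-* c (s i) ⟨
    ∣ c * s i ∣                   ≡⟨ cong ∣_∣ (eq i) ⟩
    ∣ q * s (suc i) ∣             ≡⟨ ℤ.abs-* q (s (suc i)) ⟩
    ∣ q ∣ ℕ.* ∣ s (suc i) ∣       ≡⟨ cong (ℕ._* ∣ s (suc i) ∣) (trans (ℕ.*-comm g q′) q≡) ⟨
    g ℕ.* q′ ℕ.* ∣ s (suc i) ∣    ≡⟨ ℕ.*-assoc g q′ _ ⟩
    g ℕ.* (q′ ℕ.* ∣ s (suc i) ∣)  ∎)
    where open ≡-Reasoning
  q′≡1 : q′ ≡ 1
  q′≡1 = coprime-quotients-unit c′ q′ (ℕ.coprime-/gcd ∣ q ∣ ∣ c ∣) (∣_∣ ∘ s)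
           (s0≢0 ∘ ℤ.∣i∣≡0⇒i≡0) eq′
  q≡g : g ≡ ∣ q ∣
  q≡g = trans (sym (ℕ.*-identityˡ g)) (trans (cong (ℕ._* g) (sym q′≡1)) q≡)

-- Powers of a prime and cancellation modulo them

pow1 : ∀ p → + (p ^ 1) ≡ + p
pow1 p = cong +_ (ℕ.^-identityʳ p)

pow-suc : ∀ p j → + (p ^ suc j) ≡ + p * + (p ^ j)
pow-suc p j = ℤ.pos-* p (p ^ j)

pow2 : ∀ p → + (p ^ 2) ≡ + p * + p
pow2 p = trans (pow-suc p 1) (cong (+ p *_) (pow1 p))

pow3 : ∀ p → + (p ^ 3) ≡ + p * (+ p * + p)
pow3 p = trans (pow-suc p 2) (cong (+ p *_) (pow2 p))

module PrimeDivisor {p : ℕ} (pr : Prime p) where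

  P : ℤ
  P = + p

  instance
    P≢0 : Data.Integer.NonZero P
    P≢0 = prime⇒nonZero pr

  split : ∀ x y → P ∣ˢ x * y → P ∣ˢ x ⊎ P ∣ˢ y
  split x y d with euclidsLemma ∣ x ∣ ∣ y ∣ pr (subst (p ℕ.∣_) (ℤ.abs-* x y) (∣⇒∣ᵤ d))
  ... | inj₁ e = inj₁ (∣ᵤ⇒∣ e)
  ... | inj₂ e = inj₂ (∣ᵤ⇒∣ e)

  split-square : ∀ {x} → P ∣ˢ x * x → P ∣ˢ x
  split-square {x} d = [ id , id ]′ (split x x d)

  cancel : ∀ {x y} → ¬ P ∣ˢ x → P ∣ˢ x * y → P ∣ˢ y
  cancel {x} {y} P∤x d = [ (λ e → contradiction e P∤x) , id ]′ (split x y d)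

  cancel-pow : ∀ {x} → ¬ P ∣ˢ x → ∀ j {y} → + (p ^ j) ∣ˢ x * y → + (p ^ j) ∣ˢ y
  cancel-pow P∤x zero {y} d = divides y (sym (ℤ.*-identityʳ y))
  cancel-pow {x} P∤x (suc j) {y} d rewrite pow-suc p j
    with cancel P∤x (∣-trans (divides (+ (p ^ j)) (ℤ.*-comm P _)) d)
  ... | divides y′ refl = ∣-resp (ℤ.*-comm P y′) (*-monoʳ-∣ P (cancel-pow P∤x j
          (*-cancelˡ-∣ P (∣-resp (solve 3 (λ x y p → x :* (y :* p) := p :* (x :* y)) refl x y′ P) d))))
  
  cancel-square : ∀ {x y} → ¬ P ∣ˢ x → P * P ∣ˢ x * y → P * P ∣ˢ y
  cancel-square {x} {y} P∤x d = subst (_∣ˢ y) (pow2 p)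
    (cancel-pow P∤x 2 (subst (_∣ˢ x * y) (sym (pow2 p)) d))

  cancel-cube : ∀ {x y} → ¬ P ∣ˢ x → P * (P * P) ∣ˢ x * y → P * (P * P) ∣ˢ y
  cancel-cube {x} {y} P∤x d = subst (_∣ˢ y) (pow3 p)
    (cancel-pow P∤x 3 (subst (_∣ˢ x * y) (sym (pow3 p)) d))

  PP⇒P : ∀ {x} → P * P ∣ˢ x → P ∣ˢ x
  PP⇒P = ∣-trans (divides P refl)

  -- The valuation of g² is even, so at least 3 means at least 4.
  cube∣square : ∀ {g} → P * (P * P) ∣ˢ g * g → P * P ∣ˢ g
  cube∣square {g} d with split-square {g} (∣-trans (divides (P * P) (ℤ.*-comm P _)) d)
  ... | divides g′ refl = *-monoˡ-∣ P (split-square {g′} P∣g′²)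
    where
    P∣g′² : P ∣ˢ g′ * g′
    P∣g′² = *-cancelˡ-∣ P (*-cancelˡ-∣ P (∣-resp
      (solve 2 (λ g p → g :* p :* (g :* p) := p :* (p :* (g :* g))) refl g′ P) d))

-- Reflection of identities between quadruples into polynomial identities

v4-cong : ∀ {x0 x1 x2 x3 y0 y1 y2 y3} → x0 ≡ y0 → x1 ≡ y1 → x2 ≡ y2 → x3 ≡ y3 →
          v4 x0 x1 x2 x3 ≡ v4 y0 y1 y2 y3
v4-cong refl refl refl refl = refl

-- Quadruples of solver polynomials: an equation in `V4` is the evaluation of one in `P4`, so
-- comparing four normal forms by `refl` settles it.
record P4 (n : ℕ) : Set where
  constructor p4
  field
    e0 e1 e2 e3 : Polynomial n
open P4

⟦_⟧₄ : ∀ {n} → P4 n → Vec ℤ n → V4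
⟦ p4 a b c d ⟧₄ ρ = v4 (⟦ a ⟧ ρ) (⟦ b ⟧ ρ) (⟦ c ⟧ ρ) (⟦ d ⟧ ρ)

prove₄ : ∀ {n} (ρ : Vec ℤ n) (x y : P4 n) →
         ⟦ e0 x ⟧↓ ρ ≡ ⟦ e0 y ⟧↓ ρ → ⟦ e1 x ⟧↓ ρ ≡ ⟦ e1 y ⟧↓ ρ →
         ⟦ e2 x ⟧↓ ρ ≡ ⟦ e2 y ⟧↓ ρ → ⟦ e3 x ⟧↓ ρ ≡ ⟦ e3 y ⟧↓ ρ →
         ⟦ x ⟧₄ ρ ≡ ⟦ y ⟧₄ ρ
prove₄ ρ x y q0 q1 q2 q3 =
  v4-cong (prove ρ (e0 x) (e0 y) q0) (prove ρ (e1 x) (e1 y) q1)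
          (prove ρ (e2 x) (e2 y) q2) (prove ρ (e3 x) (e3 y) q3)

infixl 6 _:⊕_
_:⊕_ : ∀ {n} → P4 n → P4 n → P4 n
p4 a b c d :⊕ p4 e f g h = p4 (a :+ e) (b :+ f) (c :+ g) (d :+ h)

infixl 7 _:•_
_:•_ : ∀ {n} → Polynomial n → P4 n → P4 n
s :• p4 e f g h = p4 (s :* e) (s :* f) (s :* g) (s :* h)

:0 :1 :2 :4 : ∀ {n} → Polynomial n
:0 = con (+ 0)
:1 = con (+ 1)
:2 = con (+ 2)
:4 = con (+ 4)

module Symbolic {n} (A B C : Polynomial n) where

  infixl 7 _:⊗_
  _:⊗_ : P4 n → P4 n → P4 n
  p4 x0 x1 x2 x3 :⊗ p4 y0 y1 y2 y3 =
    (x0 :* y0) :• p4 :1 :0 :0 :0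
    :⊕ (x0 :* y1 :+ x1 :* y0) :• p4 :0 :1 :0 :0
    :⊕ (x0 :* y2 :+ x2 :* y0) :• p4 :0 :0 :1 :0
    :⊕ (x0 :* y3 :+ x3 :* y0) :• p4 :0 :0 :0 :1
    :⊕ (x1 :* y1) :• p4 :0 (:- B) A :0
    :⊕ (x1 :* y2 :+ x2 :* y1) :• p4 :0 (:- a2) :0 A
    -- The double negation is - a1 for a1 = - B, left unsimplified so that evaluation agrees
    -- definitionally with `mulQ (formABC A B C)`.
    :⊕ (x1 :* y3 :+ x3 :* y1) :• p4 (:- (A :* A)) (:- (:- B)) :0 :0
    :⊕ (x2 :* y2) :• p4 (:- (A :* A)) (:- (:- B)) (:- a2) B
    :⊕ (x2 :* y3 :+ x3 :* y2) :• p4 (:- (A :* B)) (:- A) (:- (:- B)) :0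
    :⊕ (x3 :* y3) :• p4 (:- (A :* a2)) :0 (:- A) (:- (:- B))
    where
    a2 : Polynomial n
    a2 = C :- :2 :* A

module SymbolicForms {k} (A B C : Polynomial k) where

  :mul0 :mul1 :norm0 :norm1 : Polynomial k → Polynomial k → Polynomial k → Polynomial k → Polynomial k
  :mul0 a b c d = a :* c :- b :* d :* A :* C
  :mul1 a b c d = a :* d :+ b :* c :- b :* d :* B
  :norm0 a b m n = a :* a :- b :* b :* A :* C :- n :* a :* C :- b :* m :* A :* C
                   :- (m :* m :* A :* A :+ :2 :* m :* n :* A :* B :+ n :* n :* (B :* B :- A :* C))
  :norm1 a b m n = :2 :* a :* b :- b :* b :* B :+ a :* m :- b :* m :* B :- n :* b :* C
                   :- (:2 :* m :* n :* A :+ n :* n :* B)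

  :normO :S :Q :T :g :X0 :X1 : Polynomial k → Polynomial k → Polynomial k
  :normO a b = a :* a :- a :* b :* B :+ b :* b :* A :* C
  :S m n = :2 :* (m :* n) :* A :+ B :* (n :* n)
  :Q m n = B :* (m :* m) :+ :2 :* (m :* n) :* C
  :T m n = A :* (m :* m) :- C :* (n :* n)
  :g m n = A :* (m :* m) :+ B :* (m :* n) :+ C :* (n :* n)
  :X0 m n = (:4 :* A :- C) :* :T m n :+ :4 :* (B :* :S m n)
  :X1 m n = :4 :* :S m n :- :Q m n

  :discO :E :N : Polynomial k
  :discO = B :* B :- :4 :* A :* C
  :E = :4 :* A :- C
  :N = :E :* :E :+ :4 :* (B :* B)

  :conj : P4 k → P4 k
  :conj (p4 x0 x1 x2 x3) = p4 (x0 :- B :* x1 :+ B :* x3 :+ (:2 :* A :- C) :* x2) x3 (:- x2) x1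

  :order : Polynomial k → Polynomial k → P4 k
  :order a b = p4 (a :- b :* B) b :0 b

  :element : Polynomial k → Polynomial k → Polynomial k → Polynomial k → P4 k
  :element a b m n = p4 (a :- b :* B :- n :* A) (b :+ m) n b

-- The quartic ring as a commutative ring, and its quadratic overrings

module QuarticRing (A B C : ℤ) where

  infixl 7 _⊗_
  opaque
    -- Opaque, so that products stay folded in equational reasoning; only blocks that compare
    -- coordinates unfold it.
    _⊗_ : V4 → V4 → V4
    _⊗_ = mulQ (formABC A B C)

  scalar : ℤ → V4
  scalar s = v4 s (+ 0) (+ 0) (+ 0)

  private
    triple : V4 → V4 → V4 → Vec ℤ 15
    triple (v4 x0 x1 x2 x3) (v4 y0 y1 y2 y3) (v4 z0 z1 z2 z3) =
      A ∷ B ∷ C ∷ x0 ∷ x1 ∷ x2 ∷ x3 ∷ y0 ∷ y1 ∷ y2 ∷ y3 ∷ z0 ∷ z1 ∷ z2 ∷ z3 ∷ []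

    X Y Z : P4 15
    X = p4 (var 3F) (var 4F) (var 5F) (var 6F)
    Y = p4 (var 7F) (var 8F) (var 9F) (var (suc 9F))
    Z = p4 (var (suc (suc 9F))) (var (suc (suc (suc 9F))))
           (var (suc (suc (suc (suc 9F))))) (var (suc (suc (suc (suc (suc 9F))))))

    open Symbolic {15} (var 0F) (var 1F) (var 2F)

  opaque
    unfolding _⊗_

    ⊗-mulQ : ∀ x y → x ⊗ y ≡ mulQ (formABC A B C) x y
    ⊗-mulQ x y = refl

    ⊗-assoc : ∀ x y z → (x ⊗ y) ⊗ z ≡ x ⊗ (y ⊗ z)
    ⊗-assoc x y z = prove₄ (triple x y z) ((X :⊗ Y) :⊗ Z) (X :⊗ (Y :⊗ Z)) refl refl refl refl

    ⊗-comm : ∀ x y → x ⊗ y ≡ y ⊗ x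
    ⊗-comm x y = prove₄ (triple x y x) (X :⊗ Y) (Y :⊗ X) refl refl refl refl

    ⊗-distribˡ-⊕ : ∀ x y z → x ⊗ (y ⊕ z) ≡ x ⊗ y ⊕ x ⊗ z
    ⊗-distribˡ-⊕ x y z = prove₄ (triple x y z) (X :⊗ (Y :⊕ Z)) (X :⊗ Y :⊕ X :⊗ Z) refl refl refl refl

    scalar-⊗ : ∀ s x → scalar s ⊗ x ≡ s • x
    scalar-⊗ s x = prove₄ (triple (scalar s) x x) (p4 (var 3F) :0 :0 :0 :⊗ Y) (var 3F :• Y)
                     refl refl refl refl

module Overrings (A B C : ℤ) where
  open QuarticRing A B C public

  0V 1V : V4
  0V = scalar (+ 0)
  1V = scalar (+ 1)

  ring : CommutativeRing 0ℓ 0ℓ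
  ring = record
    { Carrier = V4 ; _≈_ = _≡_ ; _+_ = _⊕_ ; _*_ = _⊗_ ; -_ = ⊖_ ; 0# = 0V ; 1# = 1V
    ; isCommutativeRing = record
      { isRing = record
        { +-isAbelianGroup = record
          { isGroup = record
            { isMonoid = record
              { isSemigroup = record
                { isMagma = record { isEquivalence = isEquivalence ; ∙-cong = cong₂ _⊕_ }
                ; assoc = λ (v4 a b c d) (v4 e f g h) (v4 i j k l) →
                    v4-cong (ℤ.+-assoc a e i) (ℤ.+-assoc b f j) (ℤ.+-assoc c g k) (ℤ.+-assoc d h l) }
              ; identity = (λ x → trans (⊕-comm 0V x) (⊕-identityʳ x)) , ⊕-identityʳ }
            ; inverse = (λ x → trans (⊕-comm (⊖ x) x) (⊕-inverseʳ x)) , ⊕-inverseʳ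
            ; ⁻¹-cong = cong ⊖_ }
          ; comm = ⊕-comm }
        ; *-cong = cong₂ _⊗_
        ; *-assoc = ⊗-assoc
        ; *-identity = ⊗-identityˡ , (λ x → trans (⊗-comm x 1V) (⊗-identityˡ x))
        ; distrib = ⊗-distribˡ-⊕ , (λ x y z → trans (⊗-comm (y ⊕ z) x)
            (trans (⊗-distribˡ-⊕ x y z) (cong₂ _⊕_ (⊗-comm x y) (⊗-comm x z)))) }
      ; *-comm = ⊗-comm } }
    where
    ⊕-comm : ∀ x y → x ⊕ y ≡ y ⊕ x
    ⊕-comm (v4 a b c d) (v4 e f g h) = v4-cong (ℤ.+-comm a e) (ℤ.+-comm b f) (ℤ.+-comm c g) (ℤ.+-comm d h)
    ⊕-identityʳ : ∀ x → x ⊕ 0V ≡ x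
    ⊕-identityʳ (v4 a b c d) = v4-cong (ℤ.+-identityʳ a) (ℤ.+-identityʳ b) (ℤ.+-identityʳ c) (ℤ.+-identityʳ d)
    ⊕-inverseʳ : ∀ x → x ⊕ ⊖ x ≡ 0V
    ⊕-inverseʳ (v4 a b c d) = v4-cong (ℤ.+-inverseʳ a) (ℤ.+-inverseʳ b) (ℤ.+-inverseʳ c) (ℤ.+-inverseʳ d)
    ⊗-identityˡ : ∀ x → 1V ⊗ x ≡ x
    ⊗-identityˡ x@(v4 a b c d) = trans (scalar-⊗ (+ 1) x)
      (v4-cong (ℤ.*-identityˡ a) (ℤ.*-identityˡ b) (ℤ.*-identityˡ c) (ℤ.*-identityˡ d))

  -- The overring is Q_F + (w / p) Q_F. Its multiple by p is `Adjoin`, hence the exponent k = 1, and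
  -- `w` itself shows that it is proper.
  integral⇒¬maximal : ∀ p w f e → ¬ (Σ V4 λ v → w ≡ + p • v) →
    w ⊗ w ≡ + p • (f ⊗ w ⊕ + p • e) → ¬ MaximalAt (formABC A B C) p
  integral⇒¬maximal p w f e w∉pR w² maximal = maximal (1 , Adjoin ring q w , record
    { contains = λ v → subst (Adjoin ring q w) (q-⊗ v) (adjoin-multiple ring q w v)
    ; add-closed = λ {x} {y} → adjoin-sum ring q w {x} {y}
    ; neg-closed = λ {x} → adjoin-negation ring q w {x}
    ; mul-closed = product
    ; proper = w , adjoin-generator ring q w , λ (v , eq) → w∉pR (v , trans eq (cong (_• v) (pow1 p)))
    })
    where
    q : V4
    q = scalar (+ p)
    q-⊗ : ∀ x → q ⊗ x ≡ + (p ^ 1) • x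
    q-⊗ x = trans (scalar-⊗ (+ p) x) (cong (_• x) (sym (pow1 p)))
    w²′ : w ⊗ w ≡ q ⊗ (f ⊗ w ⊕ q ⊗ e)
    w²′ = trans w² (trans (sym (scalar-⊗ (+ p) (f ⊗ w ⊕ + p • e)))
            (cong (λ x → q ⊗ (f ⊗ w ⊕ x)) (sym (scalar-⊗ (+ p) e))))
    product : ∀ {x y} → Adjoin ring q w x → Adjoin ring q w y →
              Σ V4 λ z → Adjoin ring q w z × mulQ (formABC A B C) x y ≡ + (p ^ 1) • z
    product {x} {y} x∈ y∈ =
      let z , z∈ , xy≡ = adjoin-product ring q w {f} {e} w²′ {x} {y} x∈ y∈
      in z , z∈ , trans (sym (⊗-mulQ x y)) (trans xy≡ (q-⊗ z))

-- The quadratic order ℤ[α] and fractions with bounded powers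

module QuadraticOrder (A B C : ℤ) where

  -- a + b α with α² = - B α - A C.
  mul0 mul1 : ℤ → ℤ → ℤ → ℤ → ℤ
  mul0 a b c d = a * c - b * d * A * C
  mul1 a b c d = a * d + b * c - b * d * B

  normO traceO : ℤ → ℤ → ℤ
  normO a b = a * a - a * b * B + b * b * A * C
  traceO a b = + 2 * a - b * B

  normO-mul : ∀ a b c d → normO (mul0 a b c d) (mul1 a b c d) ≡ normO a b * normO c d
  normO-mul = solve 7 (λ A B C a b c d → let open SymbolicForms A B C in
    :normO (:mul0 a b c d) (:mul1 a b c d) := :normO a b :* :normO c d) refl A B C

  normO-scale : ∀ q a b → normO (q * a) (q * b) ≡ q * q * normO a b
  normO-scale = solve 6 (λ A B C q a b → let open SymbolicForms A B C in
    :normO (q :* a) (q :* b) := q :* q :* :normO a b) refl A B C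

  -- The orbit i ↦ τⁱ (c 0 + d 0 α) of τ = (a + b α) / q stays in the order.
  Orbit : ℤ → ℤ → ℤ → (ℕ → ℤ) → (ℕ → ℤ) → Set
  Orbit q a b c d = ∀ i → mul0 a b (c i) (d i) ≡ q * c (suc i) × mul1 a b (c i) (d i) ≡ q * d (suc i)

  -- The norm is multiplicative, so it turns the orbit into a sequence of integers with ratio n(τ) =
  -- normO a b / q², to which `power-bounded⇒∣` applies. The nonzero start excludes the zero orbit,
  -- which says nothing about τ.
  orbit⇒norm-integral : ∀ {q a b c d} → q ≢ + 0 → normO (c 0) (d 0) ≢ + 0 →
    Orbit q a b c d → q * q ∣ˢ normO a b
  orbit⇒norm-integral {q} {a} {b} {c} {d} q≢0 n≢0 orbit =
    power-bounded⇒∣ (normO a b) (q * q) q²≢0 (λ i → normO (c i) (d i)) n≢0 λ i → begin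
      normO a b * normO (c i) (d i)                    ≡⟨ normO-mul a b (c i) (d i) ⟨
      normO (mul0 a b (c i) (d i)) (mul1 a b (c i) (d i))
        ≡⟨ cong₂ normO (proj₁ (orbit i)) (proj₂ (orbit i)) ⟩
      normO (q * c (suc i)) (q * d (suc i))            ≡⟨ normO-scale q (c (suc i)) (d (suc i)) ⟩
      q * q * normO (c (suc i)) (d (suc i))            ∎
    where
    open ≡-Reasoning
    q²≢0 : q * q ≢ + 0
    q²≢0 eq = q≢0 (reduce (ℤ.i*j≡0⇒i≡0∨j≡0 q eq))

  -- If s i = τⁱ (s 0), then binomial-sums s i j = (τ + 1)ⁱ (s j).
  binomial-sums : (ℕ → ℤ) → ℕ → ℕ → ℤ
  binomial-sums s zero j = s j
  binomial-sums s (suc i) j = binomial-sums s i j + binomial-sums s i (suc j)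

  orbit-binomial-sums : ∀ {q a b c d} → Orbit q a b c d → ∀ i →
    Orbit q a b (binomial-sums c i) (binomial-sums d i)
  orbit-binomial-sums orbit zero = orbit
  orbit-binomial-sums {q} {a} {b} {c} {d} orbit (suc i) j =
    let c₀ = binomial-sums c i j ; c₁ = binomial-sums c i (suc j) ; c₂ = binomial-sums c i (suc (suc j))
        d₀ = binomial-sums d i j ; d₁ = binomial-sums d i (suc j) ; d₂ = binomial-sums d i (suc (suc j))
        rec = orbit-binomial-sums {q} {a} {b} {c} {d} orbit i
    in trans (solve 9 (λ A B C a b c₀ d₀ c₁ d₁ → let open SymbolicForms A B C in
         :mul0 a b (c₀ :+ c₁) (d₀ :+ d₁) := :mul0 a b c₀ d₀ :+ :mul0 a b c₁ d₁) refl A B C a b c₀ d₀ c₁ d₁)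
         (trans (cong₂ _+_ (proj₁ (rec j)) (proj₁ (rec (suc j)))) (sym (ℤ.*-distribˡ-+ q c₁ c₂)))
     , trans (solve 9 (λ A B C a b c₀ d₀ c₁ d₁ → let open SymbolicForms A B C in
         :mul1 a b (c₀ :+ c₁) (d₀ :+ d₁) := :mul1 a b c₀ d₀ :+ :mul1 a b c₁ d₁) refl A B C a b c₀ d₀ c₁ d₁)
         (trans (cong₂ _+_ (proj₂ (rec j)) (proj₂ (rec (suc j)))) (sym (ℤ.*-distribˡ-+ q d₁ d₂)))

  -- Multiplying by τ + 1 adds to an element its multiple by τ, which is the recursion of
  -- `binomial-sums`; so the powers of τ + 1 are bounded too.
  orbit-successor : ∀ {q a b c d} → Orbit q a b c d →
    Orbit q (a + q) b (λ i → binomial-sums c i 0) (λ i → binomial-sums d i 0)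
  orbit-successor {q} {a} {b} {c} {d} orbit i =
    let c₀ = binomial-sums c i 0 ; c₁ = binomial-sums c i 1
        d₀ = binomial-sums d i 0 ; d₁ = binomial-sums d i 1
        rec0 , rec1 = orbit-binomial-sums {q} {a} {b} {c} {d} orbit i 0
    in trans (solve 8 (λ A B C a b q c d → let open SymbolicForms A B C in
         :mul0 (a :+ q) b c d := q :* c :+ :mul0 a b c d) refl A B C a b q c₀ d₀)
         (trans (cong (_+_ (q * c₀)) rec0) (sym (ℤ.*-distribˡ-+ q c₀ c₁)))
     , trans (solve 8 (λ A B C a b q c d → let open SymbolicForms A B C in
         :mul1 (a :+ q) b c d := q :* d :+ :mul1 a b c d) refl A B C a b q c₀ d₀)
         (trans (cong (_+_ (q * d₀)) rec1) (sym (ℤ.*-distribˡ-+ q d₀ d₁)))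

  -- n(τ) and n(τ + 1) are integers, hence so is tr(τ).
  orbit⇒integral : ∀ {q a b c d} → q ≢ + 0 → normO (c 0) (d 0) ≢ + 0 →
    Orbit q a b c d → q * q ∣ˢ normO a b × q ∣ˢ traceO a b
  orbit⇒integral {q} {a} {b} {c} {d} q≢0 n≢0 orbit = q²∣n ,
    *-cancelˡ-∣ q {{≢-nonZero q≢0}} (∣-resp
      (solve 6 (λ A B C q a b → let open SymbolicForms A B C in
        :normO (a :+ q) b :- :normO a b :- q :* q := q :* (:2 :* a :- b :* B))
        refl A B C q a b)
      (∣m∣n⇒∣m-n (∣m∣n⇒∣m-n q²∣n′ q²∣n) ∣-refl))
    where
    q²∣n : q * q ∣ˢ normO a b
    q²∣n = orbit⇒norm-integral {q} {a} {b} {c} {d} q≢0 n≢0 orbit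
    q²∣n′ : q * q ∣ˢ normO (a + q) b
    -- At i = 0 the binomial sum is `c 0`, so `n≢0` serves for this orbit as well.
    q²∣n′ = orbit⇒norm-integral {q} {a + q} {b} {λ i → binomial-sums c i 0} {λ i → binomial-sums d i 0}
              q≢0 n≢0 (orbit-successor {q} {a} {b} {c} {d} orbit)

  -- Integrality of (a + b α) / p is spelled out by its norm and trace. Only the denominator p is
  -- tested; `maximal-order-pow` extends this to all powers of p.
  MaximalOrder : ℤ → Set
  MaximalOrder p = ∀ a b → p * p ∣ˢ normO a b → p ∣ˢ traceO a b → p ∣ˢ a × p ∣ˢ b

-- Relative norm and trace, and descent from powers of p to p

module QuadraticExtension (A B C : ℤ) where
  open QuadraticOrder A B C public

  -- The relative norm and trace of a + b α + m β + n γ, where α = A (θ - 1/θ), β = A θ, γ = (α + B) θ.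
  norm0 norm1 : ℤ → ℤ → ℤ → ℤ → ℤ
  norm0 a b m n = a * a - b * b * A * C - n * a * C - b * m * A * C
                  - (m * m * A * A + + 2 * m * n * A * B + n * n * (B * B - A * C))
  norm1 a b m n = + 2 * a * b - b * b * B + a * m - b * m * B - n * b * C
                  - (+ 2 * m * n * A + n * n * B)

  trace0 trace1 : ℤ → ℤ → ℤ → ℤ → ℤ
  trace0 a b m n = + 2 * a - n * C
  trace1 a b m n = + 2 * b + m

  MaximalExtension : ℤ → Set
  MaximalExtension p = ∀ a b m n →
    p ∣ˢ trace0 a b m n → p ∣ˢ trace1 a b m n → p * p ∣ˢ norm0 a b m n → p * p ∣ˢ norm1 a b m n →
    (p ∣ˢ a × p ∣ˢ b) × p ∣ˢ m × p ∣ˢ n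

  norm0-scale : ∀ q a b m n → norm0 (a * q) (b * q) (m * q) (n * q) ≡ q * q * norm0 a b m n
  norm0-scale = solve 8 (λ A B C q a b m n → let open SymbolicForms A B C in
    :norm0 (a :* q) (b :* q) (m :* q) (n :* q) := q :* q :* :norm0 a b m n) refl A B C

  norm1-scale : ∀ q a b m n → norm1 (a * q) (b * q) (m * q) (n * q) ≡ q * q * norm1 a b m n
  norm1-scale = solve 8 (λ A B C q a b m n → let open SymbolicForms A B C in
    :norm1 (a :* q) (b :* q) (m :* q) (n :* q) := q :* q :* :norm1 a b m n) refl A B C

  norm0-shift : ∀ q a b m n → norm0 (a + q) b m n ≡ norm0 a b m n + q * trace0 a b m n + q * q
  norm0-shift = solve 8 (λ A B C q a b m n → let open SymbolicForms A B C in
    :norm0 (a :+ q) b m n := :norm0 a b m n :+ q :* (:2 :* a :- n :* C) :+ q :* q) refl A B C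

  norm1-shift : ∀ q a b m n → norm1 (a + q) b m n ≡ norm1 a b m n + q * trace1 a b m n
  norm1-shift = solve 8 (λ A B C q a b m n → let open SymbolicForms A B C in
    :norm1 (a :+ q) b m n := :norm1 a b m n :+ q :* (:2 :* b :+ m)) refl A B C

  module Descent {p : ℕ} (pr : Prime p) where
    open PrimeDivisor pr using (P; P≢0)

    private
      square-suc : ∀ j → + (p ^ suc j) * + (p ^ suc j) ≡ P * P * (+ (p ^ j) * + (p ^ j))
      square-suc j = trans (cong₂ _*_ (pow-suc p j) (pow-suc p j))
        (solve 2 (λ p q → p :* q :* (p :* q) := p :* p :* (q :* q)) refl P (+ (p ^ j)))

      P∣pow : ∀ j → P ∣ˢ + (p ^ suc j)
      P∣pow j = divides (+ (p ^ j)) (trans (pow-suc p j) (ℤ.*-comm P _))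

      P²∣pow² : ∀ j → P * P ∣ˢ + (p ^ suc j) * + (p ^ suc j)
      P²∣pow² j = divides (+ (p ^ j) * + (p ^ j)) (trans (square-suc j) (ℤ.*-comm (P * P) _))

      cancel-P² : ∀ j {x y} → x ≡ P * P * y → + (p ^ suc j) * + (p ^ suc j) ∣ˢ x →
                  + (p ^ j) * + (p ^ j) ∣ˢ y
      cancel-P² j {y = y} refl d = *-cancelˡ-∣ P (*-cancelˡ-∣ P
        (subst (_∣ˢ P * (P * y)) (ℤ.*-assoc P P _) (subst (P * P * (+ (p ^ j) * + (p ^ j)) ∣ˢ_) (ℤ.*-assoc P P y)
          (subst (_∣ˢ P * P * y) (square-suc j) d))))

      cancel-P : ∀ j {x y} → x ≡ P * y → + (p ^ suc j) ∣ˢ x → + (p ^ j) ∣ˢ y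
      cancel-P j {y = y} refl d = *-cancelˡ-∣ P (subst (_∣ˢ P * y) (pow-suc p j) d)

      add-P : ∀ j {x} → + (p ^ j) ∣ˢ x → + (p ^ suc j) ∣ˢ x * P
      add-P j {x} d = subst (_∣ˢ x * P) (trans (ℤ.*-comm _ P) (sym (pow-suc p j))) (*-monoˡ-∣ P d)

      1∣ : ∀ x → + (p ^ 0) ∣ˢ x
      1∣ x = divides x (sym (ℤ.*-identityʳ x))

    -- Dividing the coordinates by p removes p² from the norm and p from the trace, so the
    -- hypotheses at exponent j + 1 become those at j.
    maximal-order-pow : MaximalOrder P → ∀ j a b →
      + (p ^ j) * + (p ^ j) ∣ˢ normO a b → + (p ^ j) ∣ˢ traceO a b → + (p ^ j) ∣ˢ a × + (p ^ j) ∣ˢ b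
    maximal-order-pow max zero a b _ _ = 1∣ a , 1∣ b
    maximal-order-pow max (suc j) a b n t =
      step a b n t (max a b (∣-trans (P²∣pow² j) n) (∣-trans (P∣pow j) t))
      where
      step : ∀ a b → + (p ^ suc j) * + (p ^ suc j) ∣ˢ normO a b → + (p ^ suc j) ∣ˢ traceO a b →
             P ∣ˢ a × P ∣ˢ b → + (p ^ suc j) ∣ˢ a × + (p ^ suc j) ∣ˢ b
      step _ _ n t (divides a′ refl , divides b′ refl) =
        let a∣ , b∣ = maximal-order-pow max j a′ b′
              (cancel-P² j (trans (cong₂ normO (ℤ.*-comm a′ P) (ℤ.*-comm b′ P)) (normO-scale P a′ b′)) n)
              (cancel-P j (solve 4 (λ B P a b → :2 :* (a :* P) :- b :* P :* B :=
                 P :* (:2 :* a :- b :* B)) refl B P a′ b′) t)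
        in add-P j a∣ , add-P j b∣

    maximal-extension-pow : MaximalExtension P → ∀ j a b m n →
      + (p ^ j) ∣ˢ trace0 a b m n → + (p ^ j) ∣ˢ trace1 a b m n →
      + (p ^ j) * + (p ^ j) ∣ˢ norm0 a b m n → + (p ^ j) * + (p ^ j) ∣ˢ norm1 a b m n →
      (+ (p ^ j) ∣ˢ a × + (p ^ j) ∣ˢ b) × + (p ^ j) ∣ˢ m × + (p ^ j) ∣ˢ n
    maximal-extension-pow max zero a b m n _ _ _ _ = (1∣ a , 1∣ b) , 1∣ m , 1∣ n
    maximal-extension-pow max (suc j) a b m n t0 t1 n0 n1 =
      step a b m n t0 t1 n0 n1
        (max a b m n (∣-trans (P∣pow j) t0) (∣-trans (P∣pow j) t1) (∣-trans (P²∣pow² j) n0) (∣-trans (P²∣pow² j) n1))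
      where
      step : ∀ a b m n →
        + (p ^ suc j) ∣ˢ trace0 a b m n → + (p ^ suc j) ∣ˢ trace1 a b m n →
        + (p ^ suc j) * + (p ^ suc j) ∣ˢ norm0 a b m n → + (p ^ suc j) * + (p ^ suc j) ∣ˢ norm1 a b m n →
        (P ∣ˢ a × P ∣ˢ b) × P ∣ˢ m × P ∣ˢ n →
        (+ (p ^ suc j) ∣ˢ a × + (p ^ suc j) ∣ˢ b) × + (p ^ suc j) ∣ˢ m × + (p ^ suc j) ∣ˢ n
      step _ _ _ _ t0 t1 n0 n1 ((divides a′ refl , divides b′ refl) , divides m′ refl , divides n′ refl) =
        let (a∣ , b∣) , m∣ , n∣ = maximal-extension-pow max j a′ b′ m′ n′
              (cancel-P j (solve 4 (λ C P a n → :2 :* (a :* P) :- n :* P :* C :=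
                 P :* (:2 :* a :- n :* C)) refl C P a′ n′) t0)
              (cancel-P j (solve 3 (λ P b m → :2 :* (b :* P) :+ m :* P :=
                 P :* (:2 :* b :+ m)) refl P b′ m′) t1)
              (cancel-P² j (norm0-scale P a′ b′ m′ n′) n0)
              (cancel-P² j (norm1-scale P a′ b′ m′ n′) n1)
        in (add-P j a∣ , add-P j b∣) , add-P j m∣ , add-P j n∣

-- Integrality of relative norms and traces rules out overrings

module Maximality (A B C : ℤ) where
  open Overrings A B C public
  open QuadraticExtension A B C public

  -- a + b α + m β + n γ; in the basis of V4, α = ζ1 + ζ3 - B, β = ζ1, γ = ζ2 - A.
  element : ℤ → ℤ → ℤ → ℤ → V4
  element a b m n = v4 (a - b * B - n * A) (b + m) n b

  order : ℤ → ℤ → V4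
  order a b = v4 (a - b * B) b (+ 0) b

  -- The automorphism θ ↦ - 1/θ.
  conj : V4 → V4
  conj (v4 x0 x1 x2 x3) = v4 (x0 - B * x1 + B * x3 + (+ 2 * A - C) * x2) x3 (- x2) x1

  coord-a coord-b coord-m coord-n : V4 → ℤ
  coord-a (v4 x0 x1 x2 x3) = x0 + x3 * B + x2 * A
  coord-b (v4 x0 x1 x2 x3) = x3
  coord-m (v4 x0 x1 x2 x3) = x1 - x3
  coord-n (v4 x0 x1 x2 x3) = x2

  relnorm0 relnorm1 reltrace0 reltrace1 : V4 → ℤ
  relnorm0 v = norm0 (coord-a v) (coord-b v) (coord-m v) (coord-n v)
  relnorm1 v = norm1 (coord-a v) (coord-b v) (coord-m v) (coord-n v)
  reltrace0 v = trace0 (coord-a v) (coord-b v) (coord-m v) (coord-n v)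
  reltrace1 v = trace1 (coord-a v) (coord-b v) (coord-m v) (coord-n v)

  element-coords : ∀ v → element (coord-a v) (coord-b v) (coord-m v) (coord-n v) ≡ v
  element-coords (v4 x0 x1 x2 x3) = v4-cong
    (solve 5 (λ A B x0 x2 x3 → x0 :+ x3 :* B :+ x2 :* A :- x3 :* B :- x2 :* A := x0) refl A B x0 x2 x3)
    (solve 2 (λ x1 x3 → x3 :+ (x1 :- x3) := x1) refl x1 x3)
    refl refl

  order-injective : ∀ {a b c d} → order a b ≡ order c d → a ≡ c × b ≡ d
  order-injective {a} {b} {c} {d} eq =
    ∙-cancelʳ (- (d * B)) a c (trans (cong (λ x → a - x * B) (sym b≡d)) (cong V4.c0 eq)) , b≡d
    where
    b≡d : b ≡ d
    b≡d = cong V4.c3 eq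

  opaque
    unfolding _⊗_

    conj-⊗ : ∀ x y → conj (x ⊗ y) ≡ conj x ⊗ conj y
    conj-⊗ (v4 x0 x1 x2 x3) (v4 y0 y1 y2 y3) =
      prove₄ (A ∷ B ∷ C ∷ x0 ∷ x1 ∷ x2 ∷ x3 ∷ y0 ∷ y1 ∷ y2 ∷ y3 ∷ [])
        (:conj (X :⊗ Y)) (:conj X :⊗ :conj Y) refl refl refl refl
      where
      open Symbolic {11} (var 0F) (var 1F) (var 2F)
      open SymbolicForms {11} (var 0F) (var 1F) (var 2F)
      X Y : P4 11
      X = p4 (var 3F) (var 4F) (var 5F) (var 6F)
      Y = p4 (var 7F) (var 8F) (var 9F) (var (suc 9F))

    order-⊗ : ∀ a b c d → order a b ⊗ order c d ≡ order (mul0 a b c d) (mul1 a b c d)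
    order-⊗ a b c d =
      prove₄ (A ∷ B ∷ C ∷ a ∷ b ∷ c ∷ d ∷ [])
        (:order (var 3F) (var 4F) :⊗ :order (var 5F) (var 6F))
        (:order (:mul0 (var 3F) (var 4F) (var 5F) (var 6F)) (:mul1 (var 3F) (var 4F) (var 5F) (var 6F))) refl refl refl refl
      where
      open Symbolic {7} (var 0F) (var 1F) (var 2F)
      open SymbolicForms {7} (var 0F) (var 1F) (var 2F)

    element-⊗-conj : ∀ a b m n →
      element a b m n ⊗ conj (element a b m n) ≡ order (norm0 a b m n) (norm1 a b m n)
    element-⊗-conj a b m n =
      prove₄ (A ∷ B ∷ C ∷ a ∷ b ∷ m ∷ n ∷ []) (x :⊗ :conj x)
        (:order (:norm0 (var 3F) (var 4F) (var 5F) (var 6F)) (:norm1 (var 3F) (var 4F) (var 5F) (var 6F)))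
        refl refl refl refl
      where
      open Symbolic {7} (var 0F) (var 1F) (var 2F)
      open SymbolicForms {7} (var 0F) (var 1F) (var 2F)
      x : P4 7
      x = :element (var 3F) (var 4F) (var 5F) (var 6F)

    •-⊗-• : ∀ q x y → (q • x) ⊗ (q • y) ≡ (q * q) • (x ⊗ y)
    •-⊗-• q (v4 x0 x1 x2 x3) (v4 y0 y1 y2 y3) =
      prove₄ (A ∷ B ∷ C ∷ x0 ∷ x1 ∷ x2 ∷ x3 ∷ y0 ∷ y1 ∷ y2 ∷ y3 ∷ q ∷ [])
        ((s :• X) :⊗ (s :• Y)) ((s :* s) :• (X :⊗ Y)) refl refl refl refl
      where
      open Symbolic {12} (var 0F) (var 1F) (var 2F)
      X Y : P4 12
      X = p4 (var 3F) (var 4F) (var 5F) (var 6F)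
      Y = p4 (var 7F) (var 8F) (var 9F) (var (suc 9F))
      s : Polynomial 12
      s = var (suc (suc 9F))

  conj-• : ∀ q x → conj (q • x) ≡ q • conj x
  conj-• q (v4 x0 x1 x2 x3) =
    prove₄ (A ∷ B ∷ C ∷ x0 ∷ x1 ∷ x2 ∷ x3 ∷ q ∷ [])
      (:conj (var 7F :• X)) (var 7F :• :conj X)
      refl refl refl refl
    where
    open SymbolicForms {8} (var 0F) (var 1F) (var 2F)
    X : P4 8
    X = p4 (var 3F) (var 4F) (var 5F) (var 6F)

  order-• : ∀ q a b → q • order a b ≡ order (q * a) (q * b)
  order-• q a b = v4-cong (solve 4 (λ B q a b → q :* (a :- b :* B) := q :* a :- q :* b :* B) refl B q a b)
    refl (ℤ.*-zeroʳ q) refl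

  ⊗-conj : ∀ v → v ⊗ conj v ≡ order (relnorm0 v) (relnorm1 v)
  ⊗-conj v = subst (λ x → x ⊗ conj x ≡ order (relnorm0 v) (relnorm1 v)) (element-coords v)
    (element-⊗-conj (coord-a v) (coord-b v) (coord-m v) (coord-n v))

  -- Since `conj` respects products, v ⊗ conj v is multiplicative in v; it lies in the order, whose
  -- two coordinates are then compared.
  relnorm-mul : ∀ q x y z → x ⊗ y ≡ q • z →
    mul0 (relnorm0 x) (relnorm1 x) (relnorm0 y) (relnorm1 y) ≡ q * q * relnorm0 z ×
    mul1 (relnorm0 x) (relnorm1 x) (relnorm0 y) (relnorm1 y) ≡ q * q * relnorm1 z
  relnorm-mul q x y z xy≡qz = order-injective (begin
    order (mul0 (relnorm0 x) (relnorm1 x) (relnorm0 y) (relnorm1 y))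
          (mul1 (relnorm0 x) (relnorm1 x) (relnorm0 y) (relnorm1 y))
      ≡⟨ order-⊗ (relnorm0 x) (relnorm1 x) (relnorm0 y) (relnorm1 y) ⟨
    order (relnorm0 x) (relnorm1 x) ⊗ order (relnorm0 y) (relnorm1 y)
      ≡⟨ cong₂ _⊗_ (⊗-conj x) (⊗-conj y) ⟨
    (x ⊗ conj x) ⊗ (y ⊗ conj y)
      ≡⟨ interchange ring x (conj x) y (conj y) ⟩
    (x ⊗ y) ⊗ (conj x ⊗ conj y)
      ≡⟨ cong ((x ⊗ y) ⊗_) (conj-⊗ x y) ⟨
    (x ⊗ y) ⊗ conj (x ⊗ y)
      ≡⟨ cong (λ v → v ⊗ conj v) xy≡qz ⟩
    (q • z) ⊗ conj (q • z)
      ≡⟨ cong ((q • z) ⊗_) (conj-• q z) ⟩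
    (q • z) ⊗ (q • conj z)
      ≡⟨ •-⊗-• q z (conj z) ⟩
    (q * q) • (z ⊗ conj z)
      ≡⟨ cong ((q * q) •_) (⊗-conj z) ⟩
    (q * q) • order (relnorm0 z) (relnorm1 z)
      ≡⟨ order-• (q * q) (relnorm0 z) (relnorm1 z) ⟩
    order (q * q * relnorm0 z) (q * q * relnorm1 z) ∎)
    where open ≡-Reasoning

  coords-add-scalar : ∀ q v → let w = v ⊕ q • 1V in
    coord-a w ≡ coord-a v + q × coord-b w ≡ coord-b v × coord-m w ≡ coord-m v × coord-n w ≡ coord-n v
  coords-add-scalar q (v4 x0 x1 x2 x3) =
      solve 6 (λ A B q x0 x2 x3 → x0 :+ q :* :1 :+ (x3 :+ q :* :0) :* B :+ (x2 :+ q :* :0) :* A :=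
        x0 :+ x3 :* B :+ x2 :* A :+ q) refl A B q x0 x2 x3
    , solve 2 (λ q x3 → x3 :+ q :* :0 := x3) refl q x3
    , solve 3 (λ q x1 x3 → x1 :+ q :* :0 :- (x3 :+ q :* :0) := x1 :- x3) refl q x1 x3
    , solve 2 (λ q x2 → x2 :+ q :* :0 := x2) refl q x2

  relnorm0-add-scalar : ∀ q v → relnorm0 (v ⊕ q • 1V) ≡ relnorm0 v + q * reltrace0 v + q * q
  relnorm0-add-scalar q v =
    let ea , eb , em , en = coords-add-scalar q v
    in trans (cong₂ (λ f n → f n) (cong₂ (λ f m → f m) (cong₂ norm0 ea eb) em) en)
         (norm0-shift q (coord-a v) (coord-b v) (coord-m v) (coord-n v))

  relnorm1-add-scalar : ∀ q v → relnorm1 (v ⊕ q • 1V) ≡ relnorm1 v + q * reltrace1 v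
  relnorm1-add-scalar q v =
    let ea , eb , em , en = coords-add-scalar q v
    in trans (cong₂ (λ f n → f n) (cong₂ (λ f m → f m) (cong₂ norm1 ea eb) em) en)
         (norm1-shift q (coord-a v) (coord-b v) (coord-m v) (coord-n v))

  relnorm0-scalar : ∀ q → relnorm0 (q • 1V) ≡ q * q
  relnorm0-scalar q = solve 4 (λ A B C q → let open SymbolicForms A B C in
      :norm0 (q :* :1 :+ q :* :0 :* B :+ q :* :0 :* A) (q :* :0) (q :* :0 :- q :* :0) (q :* :0) := q :* q)
      refl A B C q

  relnorm1-scalar : ∀ q → relnorm1 (q • 1V) ≡ + 0
  relnorm1-scalar q = solve 4 (λ A B C q → let open SymbolicForms A B C in
      :norm1 (q :* :1 :+ q :* :0 :* B :+ q :* :0 :* A) (q :* :0) (q :* :0 :- q :* :0) (q :* :0) := :0)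
      refl A B C q

  module _ {p : ℕ} (pr : Prime p) (max-order : MaximalOrder (+ p)) (max-ext : MaximalExtension (+ p)) where
    open Descent pr

    module _ {k : ℕ} {L : V4 → Set} (overring : ProperOverring (formABC A B C) p k L) where
      open ProperOverring overring

      private
        q : ℤ
        q = + (p ^ k)

        q≢0 : q ≢ + 0
        q≢0 eq = ℕ.≢-nonZero⁻¹ (p ^ k) {{ℕ.m^n≢0 p k {{prime⇒nonZero pr}}}} (ℤ.+-injective eq)

        square≢0 : ∀ {x} → x ≢ + 0 → x * x ≢ + 0
        square≢0 {x} x≢0 eq = x≢0 (reduce (ℤ.i*j≡0⇒i≡0∨j≡0 x eq))

        q∈L : L (q • 1V)
        q∈L = contains 1V

        module _ {x} (x∈L : L x) where
          -- With L = q R', the terms are q (x / q)ⁱ. Their relative norms form the orbit of n(x) /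
          -- q² in the quadratic order.
          powers : ℕ → Σ V4 L
          powers zero = q • 1V , q∈L
          powers (suc i) = let z , z∈L , _ = mul-closed x∈L (proj₂ (powers i)) in z , z∈L

          orbit : Orbit (q * q) (relnorm0 x) (relnorm1 x) (relnorm0 ∘ proj₁ ∘ powers) (relnorm1 ∘ proj₁ ∘ powers)
          orbit i = relnorm-mul q x (proj₁ (powers i)) (proj₁ (powers (suc i)))
            (trans (⊗-mulQ x (proj₁ (powers i))) (proj₂ (proj₂ (mul-closed x∈L (proj₂ (powers i))))))

          start≢0 : normO (relnorm0 (q • 1V)) (relnorm1 (q • 1V)) ≢ + 0
          start≢0 eq = square≢0 (square≢0 q≢0) (begin
            q * q * (q * q)
              ≡⟨ solve 4 (λ A B C s → s :* s := s :* s :- s :* :0 :* B :+ :0 :* :0 :* A :* C) refl A B C (q * q) ⟩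
            normO (q * q) (+ 0)
              ≡⟨ cong₂ normO (relnorm0-scalar q) (relnorm1-scalar q) ⟨
            normO (relnorm0 (q • 1V)) (relnorm1 (q • 1V))
              ≡⟨ eq ⟩
            + 0 ∎)
            where open ≡-Reasoning

          q²≡ : + (p ^ (k ℕ.+ k)) ≡ q * q
          q²≡ = trans (cong +_ (ℕ.^-distribˡ-+-* p k k)) (ℤ.pos-* (p ^ k) (p ^ k))

          relnorm-integral : q * q ∣ˢ relnorm0 x × q * q ∣ˢ relnorm1 x
          relnorm-integral =
            let n∣ , t∣ = orbit⇒integral {q * q} {relnorm0 x} {relnorm1 x}
                            {relnorm0 ∘ proj₁ ∘ powers} {relnorm1 ∘ proj₁ ∘ powers}
                            (square≢0 q≢0) start≢0 orbit
            in subst (λ s → s ∣ˢ relnorm0 x × s ∣ˢ relnorm1 x) q²≡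
                 -- A relative norm carries the denominator q², so the order is tested at exponent k
                 -- + k.
                 (maximal-order-pow max-order (k ℕ.+ k) (relnorm0 x) (relnorm1 x)
                   (subst (λ s → s * s ∣ˢ normO (relnorm0 x) (relnorm1 x)) (sym q²≡) n∣)
                   (subst (_∣ˢ traceO (relnorm0 x) (relnorm1 x)) (sym q²≡) t∣))

      reltrace-integral : ∀ {x} → L x → q ∣ˢ reltrace0 x × q ∣ˢ reltrace1 x
      reltrace-integral {x} x∈L =
        let n0 , n1 = relnorm-integral x∈L
            n0′ , n1′ = relnorm-integral (add-closed x∈L q∈L)
            instance q-nonZero = ≢-nonZero q≢0
        in *-cancelˡ-∣ q (∣-resp (solve 3 (λ n q t → n :+ q :* t :+ q :* q :- n :- q :* q := q :* t) refl (relnorm0 x) q (reltrace0 x))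
             (∣m∣n⇒∣m-n (∣m∣n⇒∣m-n (∣-resp (relnorm0-add-scalar q x) n0′) n0) ∣-refl))
         , *-cancelˡ-∣ q (∣-resp (solve 3 (λ n q t → n :+ q :* t :- n := q :* t) refl (relnorm1 x) q (reltrace1 x))
             (∣m∣n⇒∣m-n (∣-resp (relnorm1-add-scalar q x) n1′) n1))

      overring-trivial : ∀ {x} → L x → Σ V4 λ v → x ≡ q • v
      overring-trivial {x} x∈L =
        let t0 , t1 = reltrace-integral x∈L
            n0 , n1 = relnorm-integral x∈L
        in assemble (coord-a x) (coord-b x) (coord-m x) (coord-n x) (element-coords x)
             (maximal-extension-pow max-ext k (coord-a x) (coord-b x) (coord-m x) (coord-n x) t0 t1 n0 n1)
        where
        assemble : ∀ a b m n → element a b m n ≡ x → (q ∣ˢ a × q ∣ˢ b) × q ∣ˢ m × q ∣ˢ n → Σ V4 λ v → x ≡ q • v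
        assemble _ _ _ _ eq ((divides a refl , divides b refl) , divides m refl , divides n refl) =
          element a b m n , trans (sym eq) (v4-cong
            (solve 6 (λ A B q a b n → a :* q :- b :* q :* B :- n :* q :* A := q :* (a :- b :* B :- n :* A)) refl A B q a b n)
            (solve 3 (λ q b m → b :* q :+ m :* q := q :* (b :+ m)) refl q b m)
            (ℤ.*-comm n q) (ℤ.*-comm b q))

    integrally-closed⇒maximal : MaximalAt (formABC A B C) p
    integrally-closed⇒maximal (k , L , overring) =
      let x , x∈L , x∉qR = ProperOverring.proper overring in x∉qR (overring-trivial overring x∈L)

odd-prime∤2 : ∀ {p} → Prime p → p ≢ 2 → ¬ + p ∣ˢ + 2
odd-prime∤2 pr p≢2 p∣2 with irreducible[2] (∣⇒∣ᵤ p∣2)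
... | inj₁ refl = ¬prime[1] pr
... | inj₂ p≡2 = p≢2 p≡2

-- Elements whose quotient by p has its square in the quadratic order

module Witnesses (A B C : ℤ) where
  open Maximality A B C public

  ring-zeroˡ : ∀ x → 0V ⊗ x ≡ 0V
  ring-zeroˡ = CommutativeRing.zeroˡ ring

  square⇒¬maximal : ∀ p w {x y} → ¬ (Σ V4 λ v → w ≡ + p • v) → w ⊗ w ≡ order x y →
    + p * + p ∣ˢ x → + p * + p ∣ˢ y → ¬ MaximalAt (formABC A B C) p
  square⇒¬maximal p w w∉pR w² (divides x refl) (divides y refl) =
    integral⇒¬maximal p w 0V (order x y) w∉pR (begin
      w ⊗ w                                       ≡⟨ w² ⟩
      order (x * (+ p * + p)) (y * (+ p * + p))   ≡⟨ v4-cong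
        (solve 4 (λ B p x y → x :* (p :* p) :- y :* (p :* p) :* B := p :* (:0 :+ p :* (x :- y :* B))) refl B (+ p) x y)
        (solve 2 (λ p y → y :* (p :* p) := p :* (:0 :+ p :* y)) refl (+ p) y)
        (solve 1 (λ p → :0 := p :* (:0 :+ p :* :0)) refl (+ p))
        (solve 2 (λ p y → y :* (p :* p) := p :* (:0 :+ p :* y)) refl (+ p) y) ⟩
      + p • (0V ⊕ + p • order x y)
        ≡⟨ cong (λ z → + p • (z ⊕ + p • order x y)) (ring-zeroˡ w) ⟨
      + p • (0V ⊗ w ⊕ + p • order x y)            ∎)
    where open ≡-Reasoning

  -- X0 e b + X1 e b α is the square of (e A + b (B + α)) (θ + 1/θ), and different-multiple e b is that
  -- multiple of the relative different θ + 1/θ.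
  X0 X1 : ℤ → ℤ → ℤ
  X0 m n = (+ 4 * A - C) * (A * (m * m) - C * (n * n)) + + 4 * (B * (+ 2 * (m * n) * A + B * (n * n)))
  X1 m n = + 4 * (+ 2 * (m * n) * A + B * (n * n)) - (B * (m * m) + + 2 * (m * n) * C)

  different-multiple : ℤ → ℤ → V4
  different-multiple e b = element (b * C) (- e) (+ 2 * e) (+ 2 * b)

  different-multiple² : ∀ e b → different-multiple e b ⊗ different-multiple e b ≡ order (X0 e b) (X1 e b)
  different-multiple² e b = begin
    w ⊗ w
      -- θ + 1/θ changes sign under θ ↦ - 1/θ, so w = - conj w, and w² is minus the relative norm.
      ≡⟨ cong (w ⊗_) (v4-cong
           (solve 5 (λ A B C e b → b :* C :- (:- e) :* B :- :2 :* b :* A :=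
             (:- :1) :* (b :* C :- (:- e) :* B :- :2 :* b :* A :- B :* (:- e :+ :2 :* e) :+ B :* (:- e) :+ (:2 :* A :- C) :* (:2 :* b)))
             refl A B C e b)
           (solve 1 (λ e → :- e :+ :2 :* e := (:- :1) :* (:- e)) refl e)
           (solve 1 (λ b → :2 :* b := (:- :1) :* (:- (:2 :* b))) refl b)
           (solve 1 (λ e → :- e := (:- :1) :* (:- e :+ :2 :* e)) refl e)) ⟩
    w ⊗ (- (+ 1) • conj w)
      ≡⟨ cong (w ⊗_) (scalar-⊗ (- (+ 1)) (conj w)) ⟨
    w ⊗ (scalar (- (+ 1)) ⊗ conj w)
      ≡⟨ ⊗-assoc w (scalar (- (+ 1))) (conj w) ⟨
    (w ⊗ scalar (- (+ 1))) ⊗ conj w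
      ≡⟨ cong (_⊗ conj w) (⊗-comm w (scalar (- (+ 1)))) ⟩
    (scalar (- (+ 1)) ⊗ w) ⊗ conj w
      ≡⟨ ⊗-assoc (scalar (- (+ 1))) w (conj w) ⟩
    scalar (- (+ 1)) ⊗ (w ⊗ conj w)
      ≡⟨ scalar-⊗ (- (+ 1)) (w ⊗ conj w) ⟩
    - (+ 1) • (w ⊗ conj w)
      ≡⟨ cong (- (+ 1) •_) (element-⊗-conj (b * C) (- e) (+ 2 * e) (+ 2 * b)) ⟩
    - (+ 1) • order n0 n1
      ≡⟨ order-• (- (+ 1)) n0 n1 ⟩
    order (- (+ 1) * n0) (- (+ 1) * n1)
      ≡⟨ cong₂ order
           (solve 5 (λ A B C e b → let open SymbolicForms A B C in
              (:- :1) :* :norm0 (b :* C) (:- e) (:2 :* e) (:2 :* b) := :X0 e b) refl A B C e b)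
           (solve 5 (λ A B C e b → let open SymbolicForms A B C in
              (:- :1) :* :norm1 (b :* C) (:- e) (:2 :* e) (:2 :* b) := :X1 e b) refl A B C e b) ⟩
    order (X0 e b) (X1 e b) ∎
    where
    open ≡-Reasoning
    w : V4
    w = different-multiple e b
    n0 n1 : ℤ
    n0 = norm0 (b * C) (- e) (+ 2 * e) (+ 2 * b)
    n1 = norm1 (b * C) (- e) (+ 2 * e) (+ 2 * b)

-- Odd primes

module OddPrime {p : ℕ} (pr : Prime p) (p≢2 : p ≢ 2) (A B C : ℤ) where
  open PrimeDivisor pr
  open Witnesses A B C

  discO E N : ℤ
  discO = B * B - + 4 * A * C
  E = + 4 * A - C
  N = E * E + + 4 * (B * B)

  P∤2 : ¬ P ∣ˢ + 2
  P∤2 = odd-prime∤2 pr p≢2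

  P∤4 : ¬ P ∣ˢ + 4
  P∤4 P∣4 = P∤2 (split-square {+ 2} P∣4)

  P∣ABC⇒PP∣disc : P ∣ˢ A → P ∣ˢ B → P ∣ˢ C → P * P ∣ˢ discO
  P∣ABC⇒PP∣disc P∣A P∣B P∣C = ∣-resp
    (solve 3 (λ A B C → :1 :* (B :* B) :+ (:- :4) :* (A :* C) := B :* B :- :4 :* A :* C) refl A B C)
    (∣-linear (+ 1) (- (+ 4)) (∣-* P∣B P∣B) (∣-* P∣A P∣C))

  module Sufficient (disc∤ : ¬ P * P ∣ˢ discO) where

    -- traceO² - 4 normO = b² discO. As p² does not divide the discriminant, p divides b, and then
    -- the trace gives 2 a.
    max-order : MaximalOrder P
    max-order a b P²∣n P∣t = P∣a , P∣b
      where
      P∣b : P ∣ˢ b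
      P∣b = decidable-stable (P ∣ˢ? b) λ P∤b → disc∤ (cancel-square P∤b (cancel-square P∤b (∣-resp
        (solve 5 (λ A B C a b → :1 :* ((:2 :* a :- b :* B) :* (:2 :* a :- b :* B)) :+ (:- :4) :* (a :* a :- a :* b :* B :+ b :* b :* A :* C)
          := b :* (b :* (B :* B :- :4 :* A :* C))) refl A B C a b)
        (∣-linear (+ 1) (- (+ 4)) (∣-* P∣t P∣t) P²∣n))))
      P∣a : P ∣ˢ a
      P∣a = cancel P∤2 (∣-resp (solve 3 (λ B a b → :1 :* (:2 :* a :- b :* B) :+ B :* b := :2 :* a) refl B a b)
              (∣-linear (+ 1) B P∣t P∣b))

    module _ (m n : ℤ) (mn : ¬ (P ∣ˢ m × P ∣ˢ n)) (x0 : P * P ∣ˢ X0 m n) (x1 : P * P ∣ˢ X1 m n) where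

      -- With ℓ₁, ℓ₂ the partial derivatives of g = G(m, n): S = n ℓ₁, Q = m ℓ₂, and 2 T = m ℓ₁ - n ℓ₂.
      private
        S Q T g ℓ₁ ℓ₂ : ℤ
        S = + 2 * (m * n) * A + B * (n * n)
        Q = B * (m * m) + + 2 * (m * n) * C
        T = A * (m * m) - C * (n * n)
        g = A * (m * m) + B * (m * n) + C * (n * n)
        ℓ₁ = + 2 * A * m + B * n
        ℓ₂ = B * m + + 2 * C * n

        either : ∀ {d u v x} → (∀ {x y} → ¬ P ∣ˢ x → d ∣ˢ x * y → d ∣ˢ y) →
                 ¬ (P ∣ˢ u × P ∣ˢ v) → d ∣ˢ u * x → d ∣ˢ v * x → d ∣ˢ x
        either {u = u} {v} cancel-d uv d∣ux d∣vx with P ∣ˢ? u | P ∣ˢ? v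
        ... | no P∤u | _ = cancel-d P∤u d∣ux
        ... | yes _ | no P∤v = cancel-d P∤v d∣vx
        ... | yes P∣u | yes P∣v = contradiction (P∣u , P∣v) uv

        squares : ∀ {u v} → ¬ (P ∣ˢ u × P ∣ˢ v) → ¬ (P ∣ˢ u * u × P ∣ˢ v * v)
        squares {u} {v} uv (d , e) = uv (split-square {u} d , split-square {v} e)

        -- With `NS≡`, this solves X0 = E T + 4 B S and X1 = 4 S - Q for T and S; Q is eliminated
        -- through A Q - C S = B T.
        NT≡ : E * X0 m n + - (+ 4 * A * B) * X1 m n ≡ T * N
        NT≡ = solve 5 (λ A B C m n → let open SymbolicForms A B C in
          :E :* :X0 m n :+ (:- (:4 :* A :* B)) :* :X1 m n := :T m n :* :N) refl A B C m n

        NS≡ : A * E * X1 m n + B * X0 m n ≡ S * N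
        NS≡ = solve 5 (λ A B C m n → let open SymbolicForms A B C in
          A :* :E :* :X1 m n :+ B :* :X0 m n := :S m n :* :N) refl A B C m n

        module _ (P∣T : P ∣ˢ T) (P∣S : P ∣ˢ S) where
          P∣Q : P ∣ˢ Q
          P∣Q = ∣-resp (solve 2 (λ S Q → :4 :* S :+ (:- :1) :* (:4 :* S :- Q) := Q) refl S Q)
                  (∣-linear (+ 4) (- (+ 1)) P∣S (PP⇒P x1))

          P∣g : P ∣ˢ g
          P∣g = split-square {g} (∣-resp
            (solve 5 (λ A B C m n → let open SymbolicForms A B C in
              :Q m n :* :S m n :+ :T m n :* :T m n := :g m n :* :g m n) refl A B C m n)
            (∣-linear Q T P∣S P∣T))

          P∣ℓ₁ : P ∣ˢ ℓ₁
          P∣ℓ₁ = either cancel mn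
            (∣-resp (solve 5 (λ A B C m n → let open SymbolicForms A B C in
              :g m n :+ :T m n := m :* (:2 :* A :* m :+ B :* n)) refl A B C m n) (∣m∣n⇒∣m+n P∣g P∣T))
            (∣-resp (solve 5 (λ A B C m n → let open SymbolicForms A B C in
              :S m n := n :* (:2 :* A :* m :+ B :* n)) refl A B C m n) P∣S)

          P∣ℓ₂ : P ∣ˢ ℓ₂
          P∣ℓ₂ = either cancel mn
            (∣-resp (solve 5 (λ A B C m n → let open SymbolicForms A B C in
              :Q m n := m :* (B :* m :+ :2 :* C :* n)) refl A B C m n) P∣Q)
            (∣-resp (solve 5 (λ A B C m n → let open SymbolicForms A B C in
              :g m n :- :T m n := n :* (B :* m :+ :2 :* C :* n)) refl A B C m n) (∣m∣n⇒∣m-n P∣g P∣T))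

          m²disc : ℓ₂ * ℓ₂ + - (+ 4 * C) * g ≡ m * m * discO
          m²disc = solve 5 (λ A B C m n → let open SymbolicForms A B C ; ℓ₂ = B :* m :+ :2 :* C :* n in
            ℓ₂ :* ℓ₂ :+ (:- (:4 :* C)) :* :g m n := m :* m :* :discO) refl A B C m n

          n²disc : ℓ₁ * ℓ₁ + - (+ 4 * A) * g ≡ n * n * discO
          n²disc = solve 5 (λ A B C m n → let open SymbolicForms A B C ; ℓ₁ = :2 :* A :* m :+ B :* n in
            ℓ₁ :* ℓ₁ :+ (:- (:4 :* A)) :* :g m n := n :* n :* :discO) refl A B C m n

          P∣disc : P ∣ˢ discO
          P∣disc = either {u = m * m} {n * n} cancel (squares mn)
            (∣-resp m²disc (∣m∣n⇒∣m+n (∣n⇒∣m*n ℓ₂ P∣ℓ₂) (∣n⇒∣m*n (- (+ 4 * C)) P∣g)))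
            (∣-resp n²disc (∣m∣n⇒∣m+n (∣n⇒∣m*n ℓ₁ P∣ℓ₁) (∣n⇒∣m*n (- (+ 4 * A)) P∣g)))

          -- Both partial derivatives vanish modulo p, so (m : n) is a double root of G modulo p,
          -- and in m² disc = ℓ₂² - 4 C g and its mirror image the squares already contribute p².
          PP∣g⇒PP∣disc : P * P ∣ˢ g → P * P ∣ˢ discO
          PP∣g⇒PP∣disc PP∣g = either {u = m * m} {n * n} cancel-square (squares mn)
            (∣-resp m²disc (∣m∣n⇒∣m+n (∣-* P∣ℓ₂ P∣ℓ₂) (∣n⇒∣m*n (- (+ 4 * C)) PP∣g)))
            (∣-resp n²disc (∣m∣n⇒∣m+n (∣-* P∣ℓ₁ P∣ℓ₁) (∣n⇒∣m*n (- (+ 4 * A)) PP∣g)))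

      -- E and B supply a third factor p, so p³ divides T N and S N, whence p divides T and S. Then
      -- p divides the discriminant, hence A C, and through E = 4 A - C both A and C.
      ramified-everywhere : P ∣ˢ E → P ∣ˢ B → ¬ ¬ P * (P * P) ∣ˢ N
      ramified-everywhere P∣E P∣B N∤ = disc∤ (P∣ABC⇒PP∣disc P∣A P∣B P∣C)
        where
        P∣T : P ∣ˢ T
        P∣T = decidable-stable (P ∣ˢ? T) λ P∤T → N∤ (cancel-cube P∤T (∣-resp
          (trans (solve 5 (λ A B E x y → E :* x :+ (:- (:4 :* A)) :* (B :* y) := E :* x :+ (:- (:4 :* A :* B)) :* y)
            refl A B E (X0 m n) (X1 m n)) NT≡)
          (∣m∣n⇒∣m+n (∣-* P∣E x0) (∣n⇒∣m*n (- (+ 4 * A)) (∣-* P∣B x1)))))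
        P∣S : P ∣ˢ S
        P∣S = decidable-stable (P ∣ˢ? S) λ P∤S → N∤ (cancel-cube P∤S (∣-resp
          (trans (solve 5 (λ A B E x y → A :* (E :* y) :+ B :* x := A :* E :* y :+ B :* x)
            refl A B E (X0 m n) (X1 m n)) NS≡)
          (∣m∣n⇒∣m+n (∣n⇒∣m*n A (∣-* P∣E x1)) (∣-* P∣B x0))))
        P∣AC : P ∣ˢ A * C
        P∣AC = cancel P∤4 (∣-resp
          (solve 3 (λ A B C → B :* B :+ (:- :1) :* (B :* B :- :4 :* A :* C) := :4 :* (A :* C)) refl A B C)
          (∣-linear B (- (+ 1)) P∣B (P∣disc P∣T P∣S)))
        P∣A×P∣C : P ∣ˢ A × P ∣ˢ C
        P∣A×P∣C = [ (λ P∣A → P∣A , ∣-resp (solve 2 (λ A C → :4 :* A :+ (:- :1) :* (:4 :* A :- C) := C) refl A C)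
                       (∣-linear (+ 4) (- (+ 1)) P∣A P∣E))
                  , (λ P∣C → cancel P∤4 (∣-resp (solve 2 (λ A C → :1 :* (:4 :* A :- C) :+ :1 :* C := :4 :* A) refl A C)
                       (∣-linear (+ 1) (+ 1) P∣E P∣C)) , P∣C) ]′ (split A C P∣AC)
        P∣A : P ∣ˢ A
        P∣A = proj₁ P∣A×P∣C
        P∣C : P ∣ˢ C
        P∣C = proj₂ P∣A×P∣C

      -- Once p divides T and S, the relation g² = Q S + T² lets E² g² and B² g² be written with
      -- terms divisible by p³. One of E and B is prime to p, so p³ divides g², hence p² divides g.
      ramified-somewhere : ¬ (P ∣ˢ E × P ∣ˢ B) → ¬ ¬ P * P ∣ˢ N
      ramified-somewhere EB N∤ = disc∤ (PP∣g⇒PP∣disc P∣T P∣S (cube∣square {g}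
        (either {u = E * E} {B * B} cancel-cube (squares EB)
          (∣-resp (solve 5 (λ A B C m n → let open SymbolicForms A B C ; S = :S m n ; x = :X0 m n ; y = :X1 m n in
            (:4 :* (S :* (S :* :N)) :+ (:- (:E :* :E)) :* (S :* y)) :+ (:1 :* (x :* x) :+ (:- (con (+ 8) :* B)) :* (S :* x))
            := :E :* :E :* (:g m n :* :g m n)) refl A B C m n)
            (∣m∣n⇒∣m+n (∣-linear (+ 4) (- (E * E)) (∣-* P∣S PP∣NS) (∣-* P∣S x1))
                       (∣-linear (+ 1) (- (+ 8 * B)) (∣-* (PP⇒P x0) x0) (∣-* P∣S x0))))
          (∣-resp (solve 5 (λ A B C m n → let open SymbolicForms A B C ; S = :S m n ; y = :X1 m n in
            (:1 :* (S :* (S :* :N)) :+ (:- (B :* B)) :* (S :* y)) :+ ((:- (:2 :* A :* :E)) :* (S :* y) :+ A :* A :* (y :* y))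
            := B :* B :* (:g m n :* :g m n)) refl A B C m n)
            (∣m∣n⇒∣m+n (∣-linear (+ 1) (- (B * B)) (∣-* P∣S PP∣NS) (∣-* P∣S x1))
                       (∣-linear (- (+ 2 * A * E)) (A * A) (∣-* P∣S x1) (∣-* (PP⇒P x1) x1)))))))
        where
        PP∣NT : P * P ∣ˢ T * N
        PP∣NT = ∣-resp NT≡ (∣-linear E (- (+ 4 * A * B)) x0 x1)
        PP∣NS : P * P ∣ˢ S * N
        PP∣NS = ∣-resp NS≡ (∣-linear (A * E) B x1 x0)
        P∣T : P ∣ˢ T
        P∣T = decidable-stable (P ∣ˢ? T) λ P∤T → N∤ (cancel-square P∤T PP∣NT)
        P∣S : P ∣ˢ S
        P∣S = decidable-stable (P ∣ˢ? S) λ P∤S → N∤ (cancel-square P∤S PP∣NS)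

    module _ (cube∤ : P ∣ˢ E × P ∣ˢ B → ¬ P * (P * P) ∣ˢ N)
             (square∤ : ¬ (P ∣ˢ E × P ∣ˢ B) → ¬ P * P ∣ˢ N) where

      no-square-multiple : ∀ m n → P * P ∣ˢ X0 m n → P * P ∣ˢ X1 m n → P ∣ˢ m × P ∣ˢ n
      no-square-multiple m n x0 x1 = decidable-stable ((P ∣ˢ? m) ×-dec (P ∣ˢ? n)) λ mn →
        let EB = λ (P∣E , P∣B) → ramified-everywhere m n mn x0 x1 P∣E P∣B (cube∤ (P∣E , P∣B))
        in ramified-somewhere m n mn x0 x1 EB (square∤ EB)

      -- `X0 m n` and `X1 m n` are the coordinates of trace² - 4 norm, here divisible by p². So p
      -- divides m and n, and the traces then give 2 a and 2 b.
      max-extension : MaximalExtension P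
      max-extension a b m n t0 t1 n0 n1 =
        let P∣m , P∣n = no-square-multiple m n
              (∣-resp (solve 7 (λ A B C a b m n → let open SymbolicForms A B C ; t0 = :2 :* a :- n :* C ; t1 = :2 :* b :+ m in
                (:1 :* (t0 :* t0) :+ (:- (A :* C)) :* (t1 :* t1)) :+ (:- :4) :* :norm0 a b m n := :X0 m n)
                refl A B C a b m n)
                (∣m∣n⇒∣m+n (∣-linear (+ 1) (- (A * C)) (∣-* t0 t0) (∣-* t1 t1)) (∣n⇒∣m*n (- (+ 4)) n0)))
              (∣-resp (solve 7 (λ A B C a b m n → let open SymbolicForms A B C ; t0 = :2 :* a :- n :* C ; t1 = :2 :* b :+ m in
                (:2 :* (t0 :* t1) :+ (:- B) :* (t1 :* t1)) :+ (:- :4) :* :norm1 a b m n := :X1 m n)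
                refl A B C a b m n)
                (∣m∣n⇒∣m+n (∣-linear (+ 2) (- B) (∣-* t0 t1) (∣-* t1 t1)) (∣n⇒∣m*n (- (+ 4)) n1)))
        in ( cancel P∤2 (∣-resp (solve 3 (λ C a n → :1 :* (:2 :* a :- n :* C) :+ C :* n := :2 :* a) refl C a n)
               (∣-linear (+ 1) C t0 P∣n))
           , cancel P∤2 (∣-resp (solve 2 (λ b m → :1 :* (:2 :* b :+ m) :+ (:- :1) :* m := :2 :* b) refl b m)
               (∣-linear (+ 1) (- (+ 1)) t1 P∣m)) )
           , P∣m , P∣n

      maximal : MaximalAt (formABC A B C) p
      maximal = integrally-closed⇒maximal pr max-order max-extension

  module Necessary (max : MaximalAt (formABC A B C) p) where

    disc∤ : ¬ P * P ∣ˢ discO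
    -- The witness is B + 2 α, a square root of the discriminant of the order.
    disc∤ PP∣disc = square⇒¬maximal p (order B (+ 2)) w∉pR (order-⊗ B (+ 2) B (+ 2))
      (∣-resp (solve 3 (λ A B C → B :* B :- :4 :* A :* C := B :* B :- :2 :* :2 :* A :* C) refl A B C) PP∣disc)
      (divides (+ 0) (solve 1 (λ B → B :* :2 :+ :2 :* B :- :2 :* :2 :* B := :0) refl B)) max
      where
      w∉pR : ¬ (Σ V4 λ v → order B (+ 2) ≡ P • v)
      w∉pR (v4 _ _ _ v3 , eq) = P∤2 (divides v3 (trans (cong V4.c3 eq) (ℤ.*-comm P v3)))

    no-square-multiple : ∀ e b → P * P ∣ˢ X0 e b → P * P ∣ˢ X1 e b → ¬ ¬ (P ∣ˢ e × P ∣ˢ b)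
    no-square-multiple e b x0 x1 eb =
      square⇒¬maximal p (different-multiple e b) w∉pR (different-multiple² e b) x0 x1 max
      where
      w∉pR : ¬ (Σ V4 λ v → different-multiple e b ≡ P • v)
      w∉pR (v4 _ _ v2 v3 , eq) = eb
        ( ∣-resp (ℤ.neg-involutive e) (∣m⇒∣-m (divides v3 (trans (cong V4.c3 eq) (ℤ.*-comm P v3))))
        , cancel P∤2 (divides v2 (trans (cong V4.c2 eq) (ℤ.*-comm P v2))) )

    -- In the direction of (E, B) the square of the different multiple is (e A + b (B + α)) (e E + 4
    -- b B): the remaining terms are multiples of e B - b E.
    proportional-square : ∀ e b → e * B ≡ b * E → P * P ∣ˢ e * E + + 4 * (b * B) → ¬ ¬ (P ∣ˢ e × P ∣ˢ b)
    proportional-square e b eB≡bE d = no-square-multiple e b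
      (∣-resp (begin
        (e * A + b * B) * (e * E + + 4 * (b * B)) + b * C * (+ 0)
          ≡⟨ cong (λ z → (e * A + b * B) * (e * E + + 4 * (b * B)) + b * C * z) zero′ ⟨
        (e * A + b * B) * (e * E + + 4 * (b * B)) + b * C * (e * B - b * E)
          ≡⟨ solve 5 (λ A B C e b → let open SymbolicForms A B C in
               (e :* A :+ b :* B) :* (e :* :E :+ :4 :* (b :* B)) :+ b :* C :* (e :* B :- b :* :E) := :X0 e b)
               refl A B C e b ⟩
        X0 e b ∎)
        (∣m∣n⇒∣m+n (∣n⇒∣m*n (e * A + b * B) d) (divides (+ 0) (ℤ.*-zeroʳ (b * C)))))
      (∣-resp (begin
        b * (e * E + + 4 * (b * B)) + - e * (+ 0)
          ≡⟨ cong (λ z → b * (e * E + + 4 * (b * B)) + - e * z) zero′ ⟨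
        b * (e * E + + 4 * (b * B)) + - e * (e * B - b * E)
          ≡⟨ solve 5 (λ A B C e b → let open SymbolicForms A B C in
               b :* (e :* :E :+ :4 :* (b :* B)) :+ (:- e) :* (e :* B :- b :* :E) := :X1 e b)
               refl A B C e b ⟩
        X1 e b ∎)
        (∣m∣n⇒∣m+n (∣n⇒∣m*n b d) (divides (+ 0) (ℤ.*-zeroʳ (- e)))))
      where
      open ≡-Reasoning
      zero′ : e * B - b * E ≡ + 0
      zero′ = ℤ.i≡j⇒i-j≡0 eB≡bE

    square∤ : ¬ (P ∣ˢ E × P ∣ˢ B) → ¬ P * P ∣ˢ N
    square∤ EB d = proportional-square E B (ℤ.*-comm E B) d EB

    -- The first pair is (E, B) / p, where e E + 4 b B = N / p. If p divides that pair again, then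
    -- p² divides E and B, and the pair (1, 0) works because its square is A E - B α.
    cube∤ : P ∣ˢ E × P ∣ˢ B → ¬ P * (P * P) ∣ˢ N
    cube∤ (divides e E≡ , divides b B≡) d =
      proportional-square e b eB≡bE
        (*-cancelˡ-∣ P (∣-resp N≡ d))
        λ (P∣e , P∣b) → no-square-multiple (+ 1) (+ 0)
          (∣-resp (solve 3 (λ A B C → let open SymbolicForms A B C in A :* :E := :X0 :1 :0) refl A B C) (∣n⇒∣m*n A (PP∣ P∣e E≡)))
          (∣-resp (solve 3 (λ A B C → let open SymbolicForms A B C in (:- :1) :* B := :X1 :1 :0) refl A B C) (∣n⇒∣m*n (- (+ 1)) (PP∣ P∣b B≡)))
          λ (P∣1 , _) → P∤2 (∣m⇒∣m*n (+ 2) P∣1)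
      where
      PP∣ : ∀ {x y} → P ∣ˢ x → y ≡ x * P → P * P ∣ˢ y
      PP∣ P∣x refl = *-monoˡ-∣ P P∣x
      eB≡bE : e * B ≡ b * E
      eB≡bE = begin
        e * B        ≡⟨ cong (e *_) B≡ ⟩
        e * (b * P)  ≡⟨ solve 3 (λ e b p → e :* (b :* p) := b :* (e :* p)) refl e b P ⟩
        b * (e * P)  ≡⟨ cong (b *_) E≡ ⟨
        b * E        ∎
        where open ≡-Reasoning
      N≡ : N ≡ P * (e * E + + 4 * (b * B))
      N≡ = begin
        E * E + + 4 * (B * B)                    ≡⟨ cong₂ (λ x y → x * E + + 4 * (y * B)) E≡ B≡ ⟩
        e * P * E + + 4 * (b * P * B)
          ≡⟨ solve 5 (λ e b p x y → e :* p :* x :+ :4 :* (b :* p :* y) := p :* (e :* x :+ :4 :* (b :* y))) refl e b P E B ⟩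
        P * (e * E + + 4 * (b * B))              ∎
        where open ≡-Reasoning

-- Parity and squares modulo 4

Even Odd : ℤ → Set
Even x = + 2 ∣ˢ x
Odd x = + 2 ∣ˢ x - + 1

parity : ∀ x → Even x ⊎ Odd x
parity x = classify (x %ℕ 2) (n%ℕd<d x 2) (a≡a%ℕn+[a/ℕn]*n x 2)
  where
  classify : ∀ r → r ℕ.< 2 → x ≡ + r + (x /ℕ 2) * + 2 → Even x ⊎ Odd x
  classify 0 _ eq = inj₁ (divides (x /ℕ 2) (trans eq (ℤ.+-identityˡ _)))
  classify 1 _ eq = inj₂ (divides (x /ℕ 2) (trans (cong (_- + 1) eq)
    (solve 1 (λ y → :1 :+ y :- :1 := y) refl ((x /ℕ 2) * + 2))))
  classify (suc (suc _)) (s≤s (s≤s ())) _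

even⇒¬odd : ∀ {x} → Even x → ¬ Odd x
even⇒¬odd {x} e o = from-no (+ 2 ∣ˢ? + 1)
  (∣-resp (solve 1 (λ x → x :- (x :- :1) := :1) refl x) (∣m∣n⇒∣m-n e o))

¬even⇒odd : ∀ {x} → ¬ Even x → Odd x
¬even⇒odd {x} ¬e = [ (λ e → contradiction e ¬e) , id ]′ (parity x)

odd-* : ∀ {x y} → Odd x → Odd y → Odd (x * y)
odd-* {x} {y} ox oy = ∣-resp (solve 2 (λ x y → y :* (x :- :1) :+ :1 :* (y :- :1) := x :* y :- :1) refl x y)
  (∣-linear y (+ 1) ox oy)

odd-difference : ∀ {x y} → Odd x → Odd y → Even (x - y)
odd-difference {x} {y} ox oy = ∣-resp (solve 2 (λ x y → x :- :1 :- (y :- :1) := x :- y) refl x y) (∣m∣n⇒∣m-n ox oy)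

odd-sum : ∀ {x y} → Odd x → Odd y → Even (x + y)
odd-sum {x} {y} ox oy = ∣-resp (solve 2 (λ x y → (x :- :1 :+ (y :- :1)) :+ :2 := x :+ y) refl x y)
  (∣m∣n⇒∣m+n (∣m∣n⇒∣m+n ox oy) ∣-refl)

-- x - y and x + y have the same parity.
even-difference-of-squares : ∀ {x y} → Even (x * x - y * y) → + 4 ∣ˢ x * x - y * y
even-difference-of-squares {x} {y} d =
  ∣-resp (solve 2 (λ x y → (x :- y) :* (x :+ y) := x :* x :- y :* y) refl x y)
    ([ (λ e → ∣-* e (∣-resp (solve 2 (λ x y → (x :- y) :+ y :* :2 := x :+ y) refl x y)
                       (∣m∣n⇒∣m+n e (∣n⇒∣m*n y ∣-refl))))
     , (λ e → ∣-* (∣-resp (solve 2 (λ x y → (x :+ y) :- y :* :2 := x :- y) refl x y)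
                       (∣m∣n⇒∣m-n e (∣n⇒∣m*n y ∣-refl))) e)
     ]′ (split (x - y) (x + y)
          (∣-resp (solve 2 (λ x y → x :* x :- y :* y := (x :- y) :* (x :+ y)) refl x y) d)))
  where open PrimeDivisor prime[2]

odd-squares : ∀ {x y} → Odd x → Odd y → + 4 ∣ˢ x * x - y * y
odd-squares {x} {y} ox oy = even-difference-of-squares {x} {y}
  (odd-difference {x * x} {y * y} (odd-* {x} {x} ox ox) (odd-* {y} {y} oy oy))

-- The prime 2

module PrimeTwo (A B C : ℤ) where
  open PrimeDivisor prime[2]
  open Witnesses A B C

  cancel-odd : ∀ {x y} → Odd x → + 4 ∣ˢ x * y → + 4 ∣ˢ y
  cancel-odd {x} ox = cancel-square {x} λ ex → even⇒¬odd {x} ex ox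

  module Sufficient
    (not-all-even : ¬ (Even A × Even B × Even C)) (4∤C : ¬ + 4 ∣ˢ C)
    (4∤A : Odd C → Even B → ¬ + 4 ∣ˢ A) (4∤A-B+C : Odd C → Even B → ¬ + 4 ∣ˢ A - B + C) where

    even-C⇒odd-A : Even B → Even C → Odd A
    even-C⇒odd-A eB eC = ¬even⇒odd {A} λ eA → not-all-even (eA , eB , eC)

    4∤AC : Even B → ¬ + 4 ∣ˢ A * C
    4∤AC eB d with parity C
    ... | inj₁ eC = 4∤C (cancel-odd {A} (even-C⇒odd-A eB eC) d)
    ... | inj₂ oC = 4∤A oC eB (cancel-odd {C} oC (∣-resp (ℤ.*-comm A C) d))

    -- x + β + α has trace 2 x and the given norm, so half of it would be integral.
    no-half-integral : ∀ x β → B ≡ β * + 2 → ¬ + 4 ∣ˢ (x * x - β * β) + A * C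
    no-half-integral x β B≡ d with parity (A * C)
    ... | inj₁ eAC = 4∤AC eB (∣-resp (solve 2 (λ s t → s :+ t :- s := t) refl (x * x - β * β) (A * C))
            (∣m∣n⇒∣m-n d (even-difference-of-squares {x} {β}
              (∣-resp (solve 2 (λ s t → s :+ t :- t := s) refl (x * x - β * β) (A * C)) (∣m∣n⇒∣m-n (PP⇒P d) eAC)))))
      where
      eB : Even B
      eB = divides β B≡
    -- Here A - β and x have the same parity, so 4 divides (A - β)² - x²; adding the given norm
    -- leaves A (A - 2 β + C).
    ... | inj₂ oAC = 4∤A-B+C oC (divides β B≡) (cancel-odd {A} oA (∣-resp
            (trans (solve 4 (λ A C x β → ((A :- β) :* (A :- β) :- x :* x) :+ ((x :* x :- β :* β) :+ A :* C) :=
                       A :* (A :- β :* :2 :+ C)) refl A C x β)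
                   (cong (λ b → A * (A - b + C)) (sym B≡)))
            (∣m∣n⇒∣m+n (even-difference-of-squares {A - β} {x} (∣-resp
               (solve 4 (λ A C x β → A :* (A :+ C) :- ((A :* β) :* :2 :+ ((x :* x :- β :* β) :+ A :* C)) :=
                  (A :- β) :* (A :- β) :- x :* x) refl A C x β)
               (∣m∣n⇒∣m-n (∣n⇒∣m*n A (odd-sum {A} {C} oA oC))
                 (∣m∣n⇒∣m+n (∣n⇒∣m*n (A * β) ∣-refl) (PP⇒P d))))) d)))
      where
      oA : Odd A
      oA = ¬even⇒odd {A} λ eA → even⇒¬odd {A * C} (∣m⇒∣m*n C eA) oAC
      oC : Odd C
      oC = ¬even⇒odd {C} λ eC → even⇒¬odd {A * C} (∣n⇒∣m*n A eC) oAC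

    max-order : MaximalOrder (+ 2)
    max-order a b 4∣n 2∣t = ea , eb
      where
      even-bB : Even (b * B)
      even-bB = ∣-resp (solve 3 (λ B a b → a :* :2 :- (:2 :* a :- b :* B) := b :* B) refl B a b)
        (∣m∣n⇒∣m-n (∣n⇒∣m*n a ∣-refl) 2∣t)
      -- Since b² ≡ 1 modulo 4, the coefficient b can be replaced by 1: the norm is congruent to
      -- that of x + β + α with x = a - b β.
      odd-b⇒⊥ : Odd b → ¬ Even B
      odd-b⇒⊥ ob (divides β B≡) = no-half-integral (a - b * β) β B≡
        (∣-resp (trans (cong (λ B → a * a - a * b * B + b * b * A * C - (b * b - + 1 * + 1) * (A * C - β * β)) B≡)
           (solve 5 (λ A C a b β → a :* a :- a :* b :* (β :* :2) :+ b :* b :* A :* C :- (b :* b :- :1 :* :1) :* (A :* C :- β :* β) :=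
             ((a :- b :* β) :* (a :- b :* β) :- β :* β) :+ A :* C) refl A C a b β))
          (∣m∣n⇒∣m-n 4∣n (∣m⇒∣m*n (A * C - β * β) (odd-squares {b} {+ 1} ob (divides (+ 0) refl)))))
      eb : Even b
      eb = [ id , (λ ob → contradiction (cancel {b} (λ e → even⇒¬odd {b} e ob) even-bB) (odd-b⇒⊥ ob)) ]′ (parity b)
      ea : Even a
      ea = split-square {a} (∣-resp (solve 5 (λ A B C a b → let open SymbolicForms A B C in :normO a b :- b :* (b :* A :* C :- a :* B) := a :* a)
             refl A B C a b) (∣m∣n⇒∣m-n (PP⇒P 4∣n) (∣m⇒∣m*n (b * A * C - a * B) eb)))

    module _ (a b m n : ℤ) (em : Even m) (enC : Even (n * C))
             (4∣n0 : + 4 ∣ˢ norm0 a b m n) (4∣n1 : + 4 ∣ˢ norm1 a b m n) where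

      -- The norms without the terms that vanish modulo 4 when m is even.
      private
        n0≡ : + 4 ∣ˢ a * a - b * b * A * C - n * a * C - b * m * A * C - n * n * (B * B - A * C)
        n0≡ = ∣-resp (solve 7 (λ A B C a b m n →
            let r = a :* a :- b :* b :* A :* C :- n :* a :* C :- b :* m :* A :* C
                s = n :* n :* (B :* B :- A :* C)
            in r :- (m :* m :* A :* A :+ :2 :* m :* n :* A :* B :+ s) :+ (m :* m :* (A :* A) :+ m :* :2 :* (n :* A :* B)) := r :- s)
            refl A B C a b m n)
          (∣m∣n⇒∣m+n 4∣n0 (∣m∣n⇒∣m+n (∣m⇒∣m*n (A * A) (∣-* em em)) (∣m⇒∣m*n (n * A * B) (∣-* em (∣-refl {+ 2})))))

        n1≡ : + 4 ∣ˢ + 2 * a * b - b * b * B + a * m - b * m * B - n * b * C - n * n * B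
        n1≡ = ∣-resp (solve 6 (λ A B r m n s →
            r :- (:2 :* m :* n :* A :+ s) :+ m :* :2 :* (n :* A) := r :- s)
            refl A B (+ 2 * a * b - b * b * B + a * m - b * m * B - n * b * C) m n (n * n * B))
          (∣m∣n⇒∣m+n 4∣n1 (∣m⇒∣m*n (n * A) (∣-* em (∣-refl {+ 2}))))

      -- C is even, and modulo 4 a coordinate of the norm reduces to an odd multiple of C, against
      -- `4∤C`: for B odd it is `norm0`, with a and b odd; for B even it is `norm0` if b is even and
      -- `norm1` if b is odd.
      odd-n⇒⊥ : ¬ Odd n
      odd-n⇒⊥ on = [ B-even , B-odd ]′ (parity B)
        where
        eC : Even C
        eC = cancel {n} (λ e → even⇒¬odd {n} e on) enC

        -- Modulo 2, the norm is a² - B² + (b² + 1) B α.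
        even-a²-n²B² : Even (a * a - (n * B) * (n * B))
        even-a²-n²B² = ∣-resp (solve 7 (λ A B C a b m n →
            a :* a :- b :* b :* A :* C :- n :* a :* C :- b :* m :* A :* C :- n :* n :* (B :* B :- A :* C)
              :+ C :* (b :* b :* A :+ n :* a :+ b :* m :* A :- n :* n :* A) := a :* a :- (n :* B) :* (n :* B))
            refl A B C a b m n)
          (∣m∣n⇒∣m+n (PP⇒P n0≡) (∣m⇒∣m*n (b * b * A + n * a + b * m * A - n * n * A) eC))

        B-odd : ¬ Odd B
        B-odd oB = 4∤C (cancel-odd {n} on (cancel-odd {a} oa (∣-resp
          (solve 7 (λ A B C a b m n →
            ((a :* a :- (n :* B) :* (n :* B)) :+ (A :* C) :* (n :* n :- b :* b)) :- (m :* C :* (b :* A)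
             :+ (a :* a :- b :* b :* A :* C :- n :* a :* C :- b :* m :* A :* C :- n :* n :* (B :* B :- A :* C)))
            := a :* (n :* C)) refl A B C a b m n)
          (∣m∣n⇒∣m-n
            (∣m∣n⇒∣m+n (even-difference-of-squares {a} {n * B} even-a²-n²B²) (∣n⇒∣m*n (A * C) (odd-squares {n} {b} on ob)))
            (∣m∣n⇒∣m+n (∣m⇒∣m*n (b * A) (∣-* em eC)) n0≡)))))
          where
          oa : Odd a
          oa = ¬even⇒odd {a} λ ea → even⇒¬odd {n * B * (n * B)}
            (∣-resp (solve 2 (λ a s → a :* a :- (a :* a :- s) := s) refl a (n * B * (n * B)))
              (∣m∣n⇒∣m-n (∣m⇒∣m*n a ea) even-a²-n²B²))
            (odd-* {n * B} {n * B} (odd-* {n} {B} on oB) (odd-* {n} {B} on oB))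
          ob : Odd b
          ob = ¬even⇒odd {b} λ eb → even⇒¬odd {n * n * B}
            (∣-resp (solve 6 (λ B C a b m n →
               (:2 :* a :* b :- b :* b :* B :+ a :* m :- b :* m :* B :- n :* b :* C)
               :- (:2 :* a :* b :- b :* b :* B :+ a :* m :- b :* m :* B :- n :* b :* C :- n :* n :* B)
               := n :* n :* B) refl B C a b m n)
              (∣m∣n⇒∣m-n
                (∣-resp (solve 6 (λ B C a b m n →
                  b :* (:2 :* a :- b :* B :- m :* B :- n :* C) :+ m :* a :=
                  :2 :* a :* b :- b :* b :* B :+ a :* m :- b :* m :* B :- n :* b :* C) refl B C a b m n)
                  (∣m∣n⇒∣m+n (∣m⇒∣m*n (+ 2 * a - b * B - m * B - n * C) eb) (∣m⇒∣m*n a em)))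
                (PP⇒P n1≡)))
            (odd-* {n * n} {B} (odd-* {n} {n} on on) oB)

        B-even : ¬ Even B
        B-even eB = 4∤C (cancel-odd {b} ob (cancel-odd {n} on (∣-resp
          (solve 6 (λ B C a b m n →
            (a :* :2 :* b :+ a :* m :- (m :* B :* b :+ (b :* b :+ n :* n) :* B))
            :- (:2 :* a :* b :- b :* b :* B :+ a :* m :- b :* m :* B :- n :* b :* C :- n :* n :* B)
            := n :* (b :* C)) refl B C a b m n)
          (∣m∣n⇒∣m-n
            (∣m∣n⇒∣m-n (∣m∣n⇒∣m+n (∣m⇒∣m*n b (∣-* ea (∣-refl {+ 2}))) (∣-* ea em))
              (∣m∣n⇒∣m+n (∣m⇒∣m*n b (∣-* em eB))
                (∣-* (odd-sum {b * b} {n * n} (odd-* {b} {b} ob ob) (odd-* {n} {n} on on)) eB)))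
            n1≡))))
          where
          oA : Odd A
          oA = even-C⇒odd-A eB eC
          ea : Even a
          ea = split-square {a} (∣-resp (solve 2 (λ x y → x :- y :+ y := x) refl (a * a) (n * B * (n * B)))
            (∣m∣n⇒∣m+n even-a²-n²B² (∣m⇒∣m*n (n * B) (∣n⇒∣m*n n eB))))
          4∣AC[n²-b²] : + 4 ∣ˢ A * ((n * n - b * b) * C)
          4∣AC[n²-b²] = ∣-resp (solve 7 (λ A B C a b m n →
            (a :* a :- b :* b :* A :* C :- n :* a :* C :- b :* m :* A :* C :- n :* n :* (B :* B :- A :* C))
            :- (a :* a :- (a :* C :* n :+ (m :* C :* (b :* A) :+ B :* B :* (n :* n))))
            := A :* ((n :* n :- b :* b) :* C)) refl A B C a b m n)
            (∣m∣n⇒∣m-n n0≡ (∣m∣n⇒∣m-n (∣-* ea ea) (∣m∣n⇒∣m+n (∣m⇒∣m*n n (∣-* ea eC))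
              (∣m∣n⇒∣m+n (∣m⇒∣m*n (b * A) (∣-* em eC)) (∣m⇒∣m*n (n * n) (∣-* eB eB))))))
          ob : Odd b
          ob = ¬even⇒odd {b} λ eb → 4∤C (cancel-odd {n * n - b * b}
            (∣-resp (solve 2 (λ x b → x :- :1 :- b :* b := x :- b :* b :- :1) refl (n * n) b)
              (∣m∣n⇒∣m-n (odd-* {n} {n} on on) (∣m⇒∣m*n b eb)))
            (cancel-odd {A} oA 4∣AC[n²-b²]))

      module _ (en : Even n) where
        private
          n0≡′ : + 4 ∣ˢ a * a - b * b * A * C - n * a * C - b * m * A * C
          n0≡′ = ∣-resp (solve 3 (λ r n s → r :- n :* n :* s :+ n :* n :* s := r) refl
                    (a * a - b * b * A * C - n * a * C - b * m * A * C) n (B * B - A * C))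
                    (∣m∣n⇒∣m+n n0≡ (∣m⇒∣m*n (B * B - A * C) (∣-* en en)))

          n1≡′ : + 4 ∣ˢ + 2 * a * b - b * b * B + a * m - b * m * B - n * b * C
          n1≡′ = ∣-resp (solve 3 (λ r n s → r :- n :* n :* s :+ n :* n :* s := r) refl
                    (+ 2 * a * b - b * b * B + a * m - b * m * B - n * b * C) n B)
                    (∣m∣n⇒∣m+n n1≡ (∣m⇒∣m*n B (∣-* en en)))

          even-a²-b²AC : Even (a * a - b * b * (A * C))
          even-a²-b²AC = ∣-resp (solve 6 (λ A C a b m n →
              (a :* a :- b :* b :* A :* C :- n :* a :* C :- b :* m :* A :* C) :+ (n :* (a :* C) :+ m :* (b :* A :* C))
              := a :* a :- b :* b :* (A :* C)) refl A C a b m n)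
            (∣m∣n⇒∣m+n (PP⇒P n0≡′) (∣m∣n⇒∣m+n (∣m⇒∣m*n (a * C) en) (∣m⇒∣m*n (b * A * C) em)))

          module _ (ob : Odd b) where
            eB : Even B
            eB = cancel {b * b} (λ e → even⇒¬odd {b * b} e (odd-* {b} {b} ob ob)) (∣-resp
              (solve 6 (λ B C a b m n →
                (a :* b :* :2 :+ (m :* (a :- b :* B) :- n :* (b :* C)))
                :- (:2 :* a :* b :- b :* b :* B :+ a :* m :- b :* m :* B :- n :* b :* C)
                := b :* b :* B) refl B C a b m n)
              (∣m∣n⇒∣m-n (∣m∣n⇒∣m+n (∣n⇒∣m*n (a * b) ∣-refl)
                (∣m∣n⇒∣m-n (∣m⇒∣m*n (a - b * B) em) (∣m⇒∣m*n (b * C) en))) (PP⇒P n1≡′)))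

            even-a⇒⊥ : ¬ Even a
            even-a⇒⊥ ea = 4∤AC eB (cancel-odd {b + m} (∣-resp (solve 2 (λ b m → b :- :1 :+ m := b :+ m :- :1) refl b m) (∣m∣n⇒∣m+n ob em))
              (cancel-odd {b} ob (∣-resp (solve 6 (λ A C a b m n →
                (a :* a :- a :* n :* C) :- (a :* a :- b :* b :* A :* C :- n :* a :* C :- b :* m :* A :* C)
                := b :* ((b :+ m) :* (A :* C))) refl A C a b m n)
                (∣m∣n⇒∣m-n (∣m∣n⇒∣m-n (∣-* ea ea) (∣m⇒∣m*n C (∣-* ea en))) n0≡′))))

            -- Now a, b, A, C are odd and m, n, B even, so modulo 4 `norm1` - `norm0` is 1 - B + A
            -- C, which is A (A - B + C) because A² ≡ 1 and A B ≡ B.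
            odd-a⇒⊥ : ¬ Odd a
            odd-a⇒⊥ oa = 4∤A-B+C oC eB (cancel-odd {A} oA (∣-resp
              (solve 7 (λ A B C a b m n →
                let n0 = a :* a :- b :* b :* A :* C :- n :* a :* C :- b :* m :* A :* C
                    n1 = :2 :* a :* b :- b :* b :* B :+ a :* m :- b :* m :* B :- n :* b :* C
                in (n1 :- n0) :+ ((a :* a :- :1 :* :1) :+ (A :* A :- :1 :* :1) :- A :* C :* (b :* b :- :1 :* :1))
                   :- (:2 :* (a :* b :- :1) :- B :* (b :* b :- A) :+ (n :* (a :- b) :* C :+ m :* (b :* A :* C :+ a) :- m :* B :* b))
                   := A :* (A :- B :+ C)) refl A B C a b m n)
              (∣m∣n⇒∣m-n (∣m∣n⇒∣m+n (∣m∣n⇒∣m-n n1≡′ n0≡′)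
                (∣m∣n⇒∣m-n (∣m∣n⇒∣m+n (odd-squares {a} {+ 1} oa 1-odd) (odd-squares {A} {+ 1} oA 1-odd))
                  (∣n⇒∣m*n (A * C) (odd-squares {b} {+ 1} ob 1-odd))))
                (∣m∣n⇒∣m+n (∣m∣n⇒∣m-n (∣-* (∣-refl {+ 2}) (odd-* {a} {b} oa ob))
                    (∣-* eB (odd-difference {b * b} {A} (odd-* {b} {b} ob ob) oA)))
                  (∣m∣n⇒∣m-n (∣m∣n⇒∣m+n (∣m⇒∣m*n C (∣-* en (odd-difference {a} {b} oa ob)))
                      (∣-* em (odd-sum {b * A * C} {a} (odd-* {b * A} {C} (odd-* {b} {A} ob oA) oC) oa)))
                    (∣m⇒∣m*n b (∣-* em eB)))))))
              where
              1-odd : Odd (+ 1)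
              1-odd = divides (+ 0) refl
              oAC : Odd (A * C)
              oAC = ¬even⇒odd {A * C} λ eAC → even⇒¬odd {a * a}
                (∣-resp (solve 2 (λ x y → x :- y :+ y := x) refl (a * a) (b * b * (A * C)))
                  (∣m∣n⇒∣m+n even-a²-b²AC (∣n⇒∣m*n (b * b) eAC)))
                (odd-* {a} {a} oa oa)
              oA : Odd A
              oA = ¬even⇒odd {A} λ eA → even⇒¬odd {A * C} (∣m⇒∣m*n C eA) oAC
              oC : Odd C
              oC = ¬even⇒odd {C} λ eC → even⇒¬odd {A * C} (∣n⇒∣m*n A eC) oAC

        even-b : Even b
        even-b = [ id , (λ ob → contradiction (odd-a⇒⊥ ob) λ ¬oa → [ even-a⇒⊥ ob , ¬oa ]′ (parity a)) ]′ (parity b)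

        even-a : Even a
        even-a = split-square {a} (∣-resp (solve 2 (λ x y → x :- y :+ y := x) refl (a * a) (b * b * (A * C)))
          (∣m∣n⇒∣m+n even-a²-b²AC (∣m⇒∣m*n (A * C) (∣m⇒∣m*n b even-b))))

    max-extension : MaximalExtension (+ 2)
    max-extension a b m n t0 t1 n0 n1 =
      (even-a a b m n em enC n0 n1 en , even-b a b m n em enC n0 n1 en) , em , en
      where
      em : Even m
      em = ∣-resp (solve 2 (λ b m → (:2 :* b :+ m) :- b :* :2 := m) refl b m) (∣m∣n⇒∣m-n t1 (∣n⇒∣m*n b ∣-refl))
      enC : Even (n * C)
      enC = ∣-resp (solve 3 (λ C a n → a :* :2 :- (:2 :* a :- n :* C) := n :* C) refl C a n) (∣m∣n⇒∣m-n (∣n⇒∣m*n a ∣-refl) t0)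
      en : Even n
      en = [ id , (λ on → contradiction on (odd-n⇒⊥ a b m n em enC n0 n1)) ]′ (parity n)

    maximal : MaximalAt (formABC A B C) 2
    maximal = integrally-closed⇒maximal prime[2] max-order max-extension

  opaque
    unfolding _⊗_

    -- The element is w = (α + B) (1 + θ), and the relation follows from θ² = η θ + 1 and (α + B) η
    -- = - C. When 4 divides C it makes w / 2 integral.
    ramified-square : element B (+ 1) (+ 0) (+ 1) ⊗ element B (+ 1) (+ 0) (+ 1) ≡
      order (+ 2 * B - C) (+ 2) ⊗ element B (+ 1) (+ 0) (+ 1) ⊕ order (C * B) C
    ramified-square = prove₄ (A ∷ B ∷ C ∷ []) (w :⊗ w)
      (:order (:2 :* var 1F :- var 2F) :2 :⊗ w :⊕ :order (var 2F :* var 1F) (var 2F)) refl refl refl refl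
      where
      open Symbolic {3} (var 0F) (var 1F) (var 2F)
      open SymbolicForms {3} (var 0F) (var 1F) (var 2F)
      w : P4 3
      w = :element (var 1F) :1 :0 :1

  module Necessary (max : MaximalAt (formABC A B C) 2) where

    private
      c3≡1⇒∉2R : ∀ w → V4.c3 w ≡ + 1 → ¬ (Σ V4 λ v → w ≡ + 2 • v)
      c3≡1⇒∉2R w c3≡1 (v4 _ _ _ v3 , eq) = from-no (+ 2 ∣ˢ? + 1)
        (divides v3 (trans (sym c3≡1) (trans (cong V4.c3 eq) (ℤ.*-comm (+ 2) v3))))

      •-⊗ : ∀ s f w → (s • f) ⊗ w ≡ s • (f ⊗ w)
      •-⊗ s f w = trans (cong (_⊗ w) (sym (scalar-⊗ s f))) (trans (⊗-assoc (scalar s) f w) (scalar-⊗ s (f ⊗ w)))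

      •-⊕ : ∀ s x y → s • x ⊕ s • y ≡ s • (x ⊕ y)
      •-⊕ s (v4 a b c d) (v4 e f g h) = v4-cong (sym (ℤ.*-distribˡ-+ s a e)) (sym (ℤ.*-distribˡ-+ s b f))
        (sym (ℤ.*-distribˡ-+ s c g)) (sym (ℤ.*-distribˡ-+ s d h))

    4∤C : ¬ + 4 ∣ˢ C
    4∤C (divides c C≡) = integral⇒¬maximal 2 w (order (B - + 2 * c) (+ 1)) (order (c * B) c) (c3≡1⇒∉2R w refl) (begin
      w ⊗ w
        ≡⟨ ramified-square ⟩
      order (+ 2 * B - C) (+ 2) ⊗ w ⊕ order (C * B) C
        ≡⟨ cong₂ (λ f e → f ⊗ w ⊕ e) f≡ e≡ ⟩
      (+ 2 • order (B - + 2 * c) (+ 1)) ⊗ w ⊕ + 2 • (+ 2 • order (c * B) c)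
        ≡⟨ cong (_⊕ + 2 • (+ 2 • order (c * B) c)) (•-⊗ (+ 2) (order (B - + 2 * c) (+ 1)) w) ⟩
      + 2 • (order (B - + 2 * c) (+ 1) ⊗ w) ⊕ + 2 • (+ 2 • order (c * B) c)
        ≡⟨ •-⊕ (+ 2) (order (B - + 2 * c) (+ 1) ⊗ w) (+ 2 • order (c * B) c) ⟩
      + 2 • (order (B - + 2 * c) (+ 1) ⊗ w ⊕ + 2 • order (c * B) c) ∎) max
      where
      open ≡-Reasoning
      w : V4
      w = element B (+ 1) (+ 0) (+ 1)
      f≡ : order (+ 2 * B - C) (+ 2) ≡ + 2 • order (B - + 2 * c) (+ 1)
      f≡ = trans (cong (λ z → order z (+ 2)) (trans (cong (λ C → + 2 * B - C) C≡)
             (solve 2 (λ B c → :2 :* B :- c :* :4 := :2 :* (B :- :2 :* c)) refl B c)))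
             (sym (order-• (+ 2) (B - + 2 * c) (+ 1)))
      e≡ : order (C * B) C ≡ + 2 • (+ 2 • order (c * B) c)
      e≡ = trans (cong₂ order
             (trans (cong (_* B) C≡) (solve 2 (λ B c → c :* :4 :* B := :2 :* (:2 :* (c :* B))) refl B c))
             (trans C≡ (solve 1 (λ c → c :* :4 := :2 :* (:2 :* c)) refl c)))
             (sym (trans (cong (+ 2 •_) (order-• (+ 2) (c * B) c)) (order-• (+ 2) (+ 2 * (c * B)) (+ 2 * c))))

    -- (α + c)/2 would be integral of trace c - B/2 and norm n(α + c)/4.
    4∤normO : ∀ c → Even B → ¬ + 4 ∣ˢ normO c (+ 1)
    4∤normO c (divides β B≡) (divides ν n≡) =
      integral⇒¬maximal 2 w (scalar (c - β)) (scalar (- ν)) (c3≡1⇒∉2R w refl) (begin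
        w ⊗ w
          ≡⟨ order-⊗ c (+ 1) c (+ 1) ⟩
        order (mul0 c (+ 1) c (+ 1)) (mul1 c (+ 1) c (+ 1))
          ≡⟨ v4-cong
               (trans (solve 4 (λ A B C c → let open SymbolicForms A B C in
                  :mul0 c :1 c :1 :- :mul1 c :1 c :1 :* B := (:2 :* c :- B) :* (c :- :1 :* B) :- :normO c :1)
                  refl A B C c)
                 (trans (cong₂ (λ b n → (+ 2 * c - b) * (c - + 1 * B) - n) B≡ n≡)
                   (solve 4 (λ B c β ν → (:2 :* c :- β :* :2) :* (c :- :1 :* B) :- ν :* :4
                     := :2 :* ((c :- β) :* (c :- :1 :* B) :+ :2 :* (:- ν))) refl B c β ν)))
               mul1≡
               (solve 1 (λ f → :0 := :2 :* (f :* :0 :+ :2 :* :0)) refl (c - β))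
               mul1≡ ⟩
        + 2 • ((c - β) • w ⊕ + 2 • scalar (- ν))
          ≡⟨ cong (λ z → + 2 • (z ⊕ + 2 • scalar (- ν))) (scalar-⊗ (c - β) w) ⟨
        + 2 • (scalar (c - β) ⊗ w ⊕ + 2 • scalar (- ν)) ∎) max
      where
      open ≡-Reasoning
      w : V4
      w = order c (+ 1)
      mul1≡ : mul1 c (+ 1) c (+ 1) ≡ + 2 * ((c - β) * + 1 + + 2 * + 0)
      mul1≡ = trans (cong (λ b → c * + 1 + + 1 * c - + 1 * + 1 * b) B≡)
        (solve 2 (λ c β → c :* :1 :+ :1 :* c :- :1 :* :1 :* (β :* :2) := :2 :* ((c :- β) :* :1 :+ :2 :* :0)) refl c β)

    4∤AC : Even B → ¬ + 4 ∣ˢ A * C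
    4∤AC eB d = 4∤normO (+ 0) eB
      (∣-resp (solve 3 (λ A B C → let open SymbolicForms A B C in A :* C := :normO :0 :1) refl A B C) d)

    -- The integral element would be (α + 1) / 2: as C is odd and B even, the norm 1 - B + A C of α
    -- + 1 is congruent to C (A - B + C) modulo 4.
    4∤A-B+C : Odd C → Even B → ¬ + 4 ∣ˢ A - B + C
    4∤A-B+C oC eB d = 4∤normO (+ 1) eB (∣-resp
      (solve 3 (λ A B C → let open SymbolicForms A B C in C :* (A :- B :+ C) :+ (B :* (C :- :1) :- (C :* C :- :1 :* :1)) :=
         :normO :1 :1) refl A B C)
      (∣m∣n⇒∣m+n (∣n⇒∣m*n C d) (∣m∣n⇒∣m-n (∣-* eB oC) (odd-squares {C} {+ 1} oC (divides (+ 0) refl)))))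

theorem4p3 : ((p : ℕ) → Prime p → ¬ (p ≡ 2) → (A B C : ℤ) →
    MaximalAt (formABC A B C) p ⇔
    (¬ ((+ p ∣ A) × (+ p ∣ B) × (+ p ∣ C))
    × ¬ (+ (p ^ 2) ∣ (B * B - (+ 4) * A * C))
    × (((+ p ∣ ((+ 4) * A - C)) × (+ p ∣ B)) →
    ¬ (+ (p ^ 3) ∣ (((+ 4) * A - C) * ((+ 4) * A - C) + (+ 4) * (B * B))))
    × (¬ ((+ p ∣ ((+ 4) * A - C)) × (+ p ∣ B)) →
    ¬ (+ (p ^ 2) ∣ (((+ 4) * A - C) * ((+ 4) * A - C) + (+ 4) * (B * B))))))
    × ((A B C : ℤ) →
    MaximalAt (formABC A B C) 2 ⇔
    (¬ ((+ 2 ∣ A) × (+ 2 ∣ B) × (+ 2 ∣ C))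
    × ¬ (+ 4 ∣ C)
    × ((¬ (+ 2 ∣ C) × (+ 2 ∣ B)) →
    (¬ (+ 4 ∣ A) × ¬ (+ 4 ∣ (A - B + C))))))
theorem4p3 =
  (λ p pr p≢2 A B C →
    let open OddPrime pr p≢2 A B C
        square⇒ : ∀ {x} → + (p ^ 2) ∣ x → + p * + p ∣ˢ x
        square⇒ {x} d = subst (_∣ˢ x) (pow2 p) (∣ᵤ⇒∣ d)
        ⇒square : ∀ {x} → + p * + p ∣ˢ x → + (p ^ 2) ∣ x
        ⇒square {x} d = ∣⇒∣ᵤ (subst (_∣ˢ x) (sym (pow2 p)) d)
        cube⇒ : ∀ {x} → + (p ^ 3) ∣ x → + p * (+ p * + p) ∣ˢ x
        cube⇒ {x} d = subst (_∣ˢ x) (pow3 p) (∣ᵤ⇒∣ d)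
        ⇒cube : ∀ {x} → + p * (+ p * + p) ∣ˢ x → + (p ^ 3) ∣ x
        ⇒cube {x} d = ∣⇒∣ᵤ (subst (_∣ˢ x) (sym (pow3 p)) d)
    in mk⇔
      (λ max → let open Necessary max in
          (λ (a , b , c) → disc∤ (P∣ABC⇒PP∣disc (∣ᵤ⇒∣ a) (∣ᵤ⇒∣ b) (∣ᵤ⇒∣ c)))
        , disc∤ ∘ square⇒
        , (λ (e , b) → cube∤ (∣ᵤ⇒∣ e , ∣ᵤ⇒∣ b) ∘ cube⇒)
        , (λ ¬eb → square∤ (λ (e , b) → ¬eb (∣⇒∣ᵤ e , ∣⇒∣ᵤ b)) ∘ square⇒))
      (λ (_ , disc∤ , cube∤ , square∤) → Sufficient.maximal (disc∤ ∘ ⇒square)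
        (λ (e , b) → cube∤ (∣⇒∣ᵤ e , ∣⇒∣ᵤ b) ∘ ⇒cube)
        (λ ¬eb → square∤ (λ (e , b) → ¬eb (∣ᵤ⇒∣ e , ∣ᵤ⇒∣ b)) ∘ ⇒square)))
  , λ A B C → let open PrimeTwo A B C in mk⇔
      (λ max → let open Necessary max in
          -- If A, B, C are all even, then 4 divides A C and α / 2 is integral.
          (λ (a , b , c) → 4∤AC (∣ᵤ⇒∣ b) (∣-* {+ 2} {+ 2} {A} {C} (∣ᵤ⇒∣ a) (∣ᵤ⇒∣ c)))
        , 4∤C ∘ ∣ᵤ⇒∣
        , λ (¬c , b) →
            (λ a → 4∤AC (∣ᵤ⇒∣ b) (∣m⇒∣m*n {+ 4} {A} C (∣ᵤ⇒∣ a)))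
          , 4∤A-B+C (¬even⇒odd {C} (¬c ∘ ∣⇒∣ᵤ)) (∣ᵤ⇒∣ b) ∘ ∣ᵤ⇒∣)
      (λ (not-all-even , 4∤C , c) →
        let 4∤A×4∤A-B+C = λ (oC : Odd C) (eB : Even B) → c ((λ eC → even⇒¬odd {C} (∣ᵤ⇒∣ eC) oC) , ∣⇒∣ᵤ eB)
        in Sufficient.maximal (λ (a , b , c) → not-all-even (∣⇒∣ᵤ a , ∣⇒∣ᵤ b , ∣⇒∣ᵤ c)) (4∤C ∘ ∣⇒∣ᵤ)
             (λ oC eB → proj₁ (4∤A×4∤A-B+C oC eB) ∘ ∣⇒∣ᵤ)
             (λ oC eB → proj₂ (4∤A×4∤A-B+C oC eB) ∘ ∣⇒∣ᵤ))
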